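{- All integers below are positive, and "sturdy" and "flimsy" are in base $2$. (a) Every integer with no $0$'s is sturdy. (b) Every odd integer with one $0$ is flimsy, with the exception of $5$, and is proven flimsy by multiplier $3$ or $5$; that is, for every odd integer $n\neq 5$ with one $0$, $s_2(3n)<s_2(n)$ or $s_2(5n)<s_2(n)$. (c) Every odd integer with two $0$'s is flimsy, with the exception of $51$ and the numbers with binary representation $10\,1^i\,01$, $i \geq 0$, which are all sturdy. (d) Every odd integer with three $0$'s is flimsy, with the exception of $17, 85, 89, 455$ and the numbers with binary representation $100\,1^i\,011$ or $110\,1^i\,001$, $i\geq 0$, which are all sturdy. (e) Every odd integer with four $0$'s is flimsy, with the exception of $33, 69, 73, 153, 3855$, and the numbers with binary representation $1000\,1^i\,0111$, $1100\,1^i\,0011$, $1010\,1^i\,0101$, or $1110\,1^i\,0001$, $i\geq 0$, which are all sturdy. (f) Every odd integer with five $0$'s is flimsy, with the exception of $65, 133, 161, 267, 275, 1365, 31775$, and the complementary-form numbers. (g) Every odd integer with six $0$'s is flimsy, with the exception of $129, 259, 261, 273, 385, 525, 549, 561, 585, 645, 657, 705, 771, 777, 801, 1729, 1801, 2275, 3185, 11565, 13107, 258111$, and the complementary-form numbers. (h) Every odd integer with seven $0$'s is flimsy, with the exception of $257, 515, 517, 529, 1035, 1065, 1105, 1155, 1157, 1185, 1285, 1545, 1665, 2077, 2201, 2325, 2449, 2573, 2697, 2821, 2945, 19065, 19275, 21845, 26985, 95325, 2080895$, and the complementary-form numbers. (i) Every odd integer with eight $0$'s is flimsy, with the exception of $513,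 1027, 1029, 1057, 1281, 2055, 2085, 2089, 2097, 2115, 2145, 2193, 2313, 2337, 2563, 2565, 2625, 3075, 3105, 3585, 4123, 4185, 4371, 4389, 4433, 4619, 4675, 4681, 4867, 4929, 5187, 6169, 6417, 6665, 6913, 8253, 8505, 8525, 8645, 8757, 9009, 9261, 9513, 9765, 10017, 10269, 10465, 10521, 10773, 11025, 11277, 11529, 11781, 12033, 12483, 13505, 14497, 18631, 25623, 34695, 39321, 42405, 50115, 57825, 158875, 222425, 774333, 16711935$, and the complementary-form numbers. (j) Every odd integer with nine $0$'s is flimsy, with the exception of $1025, 2051, 2057, 2065, 2177, 3073, 4131, 4165, 4233, 4361, 4369, 4417, 4641, 5129, 5185, 6273, 8215, 8277, 8339, 8401, 8711, 8773, 8835, 8897, 10261, 10385, 10757, 10881, 12307, 12369, 12803, 12865, 14353, 14849, 16443, 16569, 16835, 16947, 17073, 17451, 17577, 17745, 17955, 18081, 18459, 18585, 18963, 19089, 19467, 19593, 19971, 20097, 24605, 24633, 25025, 25137, 25641, 26145, 26649, 26691, 27153, 27657, 28161, 28679, 32893, 33401, 33909, 34417, 34925, 35433, 35941, 36449, 36957, 37465, 37973, 38481, 38989, 39497, 40005, 40513, 41021, 41529, 41769, 42037, 42545, 43053, 43561, 44069, 44577, 45085, 45593, 46101, 46609, 47117, 47625, 48133, 48641, 178481, 285975, 349525, 413075, 476625, 1290555, 1806777, 1864135, 6242685, 133956095$, and the complementary-form numbers.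
   Context: For a non-negative integer $m$, $s_2(m)$ denotes the sum of the binary digits of $m$. A positive integer $n$ is flimsy (in base $2$) if there exists a positive integer $k$ with $s_2(kn) < s_2(n)$; otherwise $n$ is sturdy. "With $j$ $0$'s" means that the binary representation of the integer (without leading zeros) contains exactly $j$ digits equal to $0$. Binary representations are strings written most significant digit first; juxtaposition is concatenation and $1^i$ is the string of $i$ ones. For a binary string $x$, $\overline{x}$ is the string obtained by replacing each digit $d$ of $x$ by $1-d$. The "complementary-form numbers" are the integers with binary representation of the form $x\,1^i\,\overline{x}$, where $i\ge 0$ and $x$ is the binary representation (without leading zeros) of a positive integer; in each item the numbers meant are those of this form that are odd and have the stated number of $0$'s (so $|x|$ equals the number of $0$'s, and $x$ begins with $1$ and ends with $0$). "Every odd integer with $j$ $0$'s is flimsy, with the exception of $E$" means that an odd positive integer with $j$ $0$'s is flimsy if and only if it is not in $E$ (members of $E$ are sturdy). -}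

module Defs where

open import Data.Digit using (toNatDigits)
open import Data.List.Base using (List; []; _∷_; _++_; filter; length; map; replicate)
open import Data.Nat.Base using (ℕ; _*_; _∸_; _<_; _>_; _%_)
open import Data.Nat.ListAction using (sum)
open import Data.Nat.Properties using (_≟_)
open import Data.Product.Base using (_×_; ∃-syntax)
open import Function.Bundles using (_⇔_)
open import Relation.Binary.PropositionalEquality.Core using (_≡_)
open import Relation.Nullary.Negation.Core using (¬_)

-- Most significant digit first, without leading zeros for positive n
-- (whereas binary 0 is the one-digit list 0 ∷ []).
binary : ℕ → List ℕ
binary = toNatDigits 2

s₂ : ℕ → ℕ
s₂ n = sum (binary n)

zeros : ℕ → ℕ
zeros n = length (filter (_≟ 0) (binary n))

Odd : ℕ → Set
Odd n = n % 2 ≡ 1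

-- Flimsy and Sturdy are only meant for positive n.
Flimsy : ℕ → Set
Flimsy n = ∃[ k ] (k > 0 × s₂ (k * n) < s₂ n)

Sturdy : ℕ → Set
Sturdy n = ¬ Flimsy n

-- The binary representation of n is u 1ⁱ v for some i ≥ 0.
OnesBetween : List ℕ → List ℕ → ℕ → Set
OnesBetween u v n = ∃[ i ] (binary n ≡ u ++ replicate i 1 ++ v)

complement : List ℕ → List ℕ
complement = map (1 ∸_)

ComplementaryForm : ℕ → Set
ComplementaryForm n =
  ∃[ m ] (m > 0 × OnesBetween (binary m) (complement (binary m)) n)

OddComplementaryForm : ℕ → ℕ → Set
OddComplementaryForm j n = Odd n × zeros n ≡ j × ComplementaryForm n

OddFlimsyExcept : ℕ → (ℕ → Set) → Set
OddFlimsyExcept j E =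
  (∀ n → Odd n → zeros n ≡ j → (Flimsy n ⇔ (¬ E n))) ×
  (∀ n → E n → Sturdy n)

{-# OPTIONS --safe #-}
module Submission where

-- Sturdiness.  For d ∣ 2 ^ m − 1 the multiples of d may be folded modulo 2 ^ m − 1 without increasing
-- the number of ones, so only finitely many multiples have to be inspected.  The number x 1ⁱ x̄ is
-- (x + 1)(2 ^ s − 1), where s is also its number of ones, and a positive multiple of 2 ^ s − 1 has at
-- least s ones.  A sporadic number n is settled by a search over the multiples of a suitable divisor.
--
-- Flimsiness.  Multiply n by k digit by digit from the least significant end, keeping the carry.
-- When the carry is k − 1, reading a one yields a one and leaves the carry alone, so beyond some
-- length all runs of ones behave alike.  The numbers with j zeros thus form a finite tree of digit
-- patterns, which is searched for patterns all of whose members are beaten by one multiplier.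

open import Defs
open import Data.Bool.Base using (Bool; true; false; T; _∧_; _∨_; if_then_else_)
open import Data.Bool.ListAction using (any; all)
open import Data.Bool.Properties using (T-∧; T-∨; T-≡)
open import Data.List.Base using (List; []; _∷_; _++_; [_]; filter; filterᵇ; length; map; replicate)
open import Data.List.Membership.Propositional using (_∈_; lose)
open import Data.List.Properties using (++-assoc; ++-identityʳ; filter-++; length-++)
open import Data.List.Relation.Unary.All as All using (All)
import Data.List.Relation.Unary.All.Properties as All
open import Data.List.Relation.Unary.Any as Any using (Any; here; there; satisfied)
open import Data.List.Relation.Unary.Any.Properties using (any⁻; map⁺; ++⁺ˡ; ++⁺ʳ)
open import Data.Nat.Base
open import Data.Nat.DivMod
open import Data.Nat.Divisibility
open import Data.Nat.Induction using (Acc; acc; <-wellFounded; <-wellFounded-fast)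
open import Data.Nat.ListAction using (sum)
open import Data.Nat.ListAction.Properties using (sum-++)
open import Data.Nat.Properties
open import Data.Nat.Solver using (module +-*-Solver)
open import Data.Product.Base using (∃-syntax; _,_; _×_; proj₁; proj₂)
open import Data.Sum.Base as Sum using (_⊎_; inj₁; inj₂) renaming ([_,_] to either)
open import Data.Unit.Base using (tt)
open import Function.Base using (_∘_)
open import Function.Bundles using (Equivalence; mk⇔)
open import Relation.Binary.PropositionalEquality hiding ([_])
open import Relation.Nullary.Decidable using (⌊_⌋; yes; no; toWitness)
open import Relation.Nullary.Negation.Core using (¬_; contradiction)

-- Both halves end in evaluations, and only soundness of the tests is proved: multipliers, sparse
-- multiples, moduli and orders are hints, so a bad entry or too little fuel makes an evaluation
-- fail but never makes a result false. Multipliers are judged by zeros. If n has `L` digits and `j`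
-- zeros, then k beats n when `s₂ (k * n) + j < L`; the demand on the product relative to its length
-- depends on `j` alone, however long the runs are. The obstacle is the exceptions. A pattern with
-- runs may have sturdy members, or members that need different multipliers; it is split by whether
-- each run is empty, so that short runs end up as single numbers and long ones share a multiplier.
-- A complementary family survives every such split and has to be recognised as a whole. The
-- multipliers 3, 5 and 7 (3 and 5 for one zero) are followed while the tree is built: numbers with
-- the same low digits share the work and whole subtrees are cut. The long lists are tried only on
-- the patterns that are left.

-- Binary digits, read off from the least significant end

-- toNatDigits runs through a local function that cannot be named from outside; stating
-- binary-digitsOnto lets unification recover it as digitsOnto.
mutual
  digitsOnto : ℕ → ∀ {m} → Acc _<_ m → List ℕ → List ℕ
  digitsOnto = _

  binary-digitsOnto : ∀ n → (0 <ᵇ n / 2) ≡ true →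
                      ∃[ p ] ∃[ m ] ∃[ w ] ∃[ ds ] binary n ≡ digitsOnto p {m} w ds
  binary-digitsOnto n eq with <-wellFounded-fast n
  binary-digitsOnto n@(suc k) eq | acc wf with 0 <ᵇ suc k / 2 | eq
  ... | .true | refl with suc k / 2 | m/n<m (suc k) 2 sz<ss | (suc k % 2) ∷ []
  ... | m | m<n | ds with wf m<n | suc k
  ... | w | p = p , m , w , ds , refl

-- Stated for two starting numbers and two accessibility proofs, because one unfolding of
-- `binary (2 + k)` leaves a call that differs in both from `binary` of the half.
digitsOnto-++ : ∀ p q {m} (v w : Acc _<_ m) ds → digitsOnto p v ds ≡ digitsOnto q w [] ++ ds
digitsOnto-++ p q {zero}  v       w       ds = refl
digitsOnto-++ p q {suc k} (acc f) (acc g) ds with 0 <ᵇ suc k / 2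
... | false = refl
... | true  = trans (digitsOnto-++ p q {h} (f h<) (g h<) (d ∷ ds))
                    (trans (sym (++-assoc (digitsOnto q {h} (g h<) []) [ d ] ds))
                           (cong (_++ ds) (sym (digitsOnto-++ q q {h} (g h<) (g h<) [ d ]))))
  where
  h = suc k / 2
  d = suc k % 2
  h< = m/n<m (suc k) 2 sz<ss

binary-/2 : ∀ k → binary (2 + k) ≡ binary ((2 + k) / 2) ++ [ (2 + k) % 2 ]
binary-/2 k with 0 <ᵇ (2 + k) / 2 | 0<half
  where
  0<half : (0 <ᵇ (2 + k) / 2) ≡ true
  0<half rewrite m/n≡1+[m∸n]/n {2 + k} {2} (s≤s (s≤s z≤n)) = refl
... | true | refl = digitsOnto-++ (2 + k) ((2 + k) / 2) {(2 + k) / 2} _ _ [ (2 + k) % 2 ]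

-- Positivity of `n` excludes `binary 0`, which is `0 ∷ []` and would remain as a leading zero. For
-- `s₂` that zero is harmless, so `s₂-step` holds for all `n`.
binary-step : ∀ {d} n → d < 2 → n > 0 → binary (d + n * 2) ≡ binary n ++ [ d ]
binary-step {d} n@(suc n-1) d<2 _ = begin
  binary (d + n * 2)                                      ≡⟨ cong binary eq ⟩
  binary (2 + (d + n-1 * 2))                              ≡⟨ binary-/2 (d + n-1 * 2) ⟩
  binary ((2 + (d + n-1 * 2)) / 2) ++ [ (2 + (d + n-1 * 2)) % 2 ]
    ≡⟨ cong (λ x → binary (x / 2) ++ [ x % 2 ]) eq ⟨
  binary ((d + n * 2) / 2) ++ [ (d + n * 2) % 2 ]
    ≡⟨ cong₂ (λ x y → binary x ++ [ y ]) q≡ r≡ ⟩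
  binary n ++ [ d ] ∎
  where
  open ≡-Reasoning
  eq : d + n * 2 ≡ 2 + (d + n-1 * 2)
  eq = trans (+-suc d _) (cong suc (+-suc d _))
  r≡ : (d + n * 2) % 2 ≡ d
  r≡ = trans ([m+kn]%n≡m%n d n 2) (m<n⇒m%n≡m d<2)
  q≡ : (d + n * 2) / 2 ≡ n
  q≡ = trans (+-distrib-/-∣ʳ d (divides n refl)) (cong₂ _+_ (m<n⇒m/n≡0 d<2) (m*n/n≡m n 2))

≡%2+/2*2 : ∀ n → n ≡ n % 2 + n / 2 * 2
≡%2+/2*2 n = m≡m%n+[m/n]*n n 2

binary-ind : ∀ {p} (P : ℕ → Set p) → P 0 → (∀ {d} n → d < 2 → P n → P (d + n * 2)) → ∀ n → P n
binary-ind P P0 Pstep n = go n (<-wellFounded n)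
  where
  go : ∀ n → Acc _<_ n → P n
  go zero      _         = P0
  go n@(suc _) (acc rec) =
    subst P (sym (≡%2+/2*2 n)) (Pstep (n / 2) (m%n<n n 2) (go (n / 2) (rec (m/n<m n 2 sz<ss))))

s₂-step : ∀ {d} n → d < 2 → s₂ (d + n * 2) ≡ d + s₂ n
s₂-step {0} zero _ = refl
s₂-step {1} zero _ = refl
s₂-step {suc (suc _)} zero (s≤s (s≤s ()))
s₂-step {d} n@(suc _) d<2 = begin
  sum (binary (d + n * 2))     ≡⟨ cong sum (binary-step n d<2 z<s) ⟩
  sum (binary n ++ [ d ])      ≡⟨ sum-++ (binary n) [ d ] ⟩
  s₂ n + (d + 0)               ≡⟨ cong (s₂ n +_) (+-identityʳ d) ⟩
  s₂ n + d                     ≡⟨ +-comm (s₂ n) d ⟩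
  d + s₂ n                     ∎
  where open ≡-Reasoning

s₂-%2+/2 : ∀ n → s₂ n ≡ n % 2 + s₂ (n / 2)
s₂-%2+/2 n = trans (cong s₂ (≡%2+/2*2 n)) (s₂-step (n / 2) (m%n<n n 2))

zeros-step : ∀ d n → n > 0 → d < 2 → zeros (d + n * 2) ≡ zeros n + length (filter (_≟ 0) [ d ])
zeros-step d n n>0 d<2 = begin
  length (filter (_≟ 0) (binary (d + n * 2)))
    ≡⟨ cong (λ ds → length (filter (_≟ 0) ds)) (binary-step n d<2 n>0) ⟩
  length (filter (_≟ 0) (binary n ++ [ d ]))
    ≡⟨ cong length (filter-++ (_≟ 0) (binary n) [ d ]) ⟩
  length (filter (_≟ 0) (binary n) ++ filter (_≟ 0) [ d ])
    ≡⟨ length-++ (filter (_≟ 0) (binary n)) ⟩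
  zeros n + length (filter (_≟ 0) [ d ]) ∎
  where open ≡-Reasoning

-- Bounds on the digit sum

s₂-suc : ∀ n → s₂ (suc n) ≤ suc (s₂ n)
s₂-suc = binary-ind (λ n → s₂ (suc n) ≤ suc (s₂ n)) ≤-refl step
  where
  step : ∀ {d} n → d < 2 → s₂ (suc n) ≤ suc (s₂ n) → s₂ (suc (d + n * 2)) ≤ suc (s₂ (d + n * 2))
  step {0} n d<2 ih = ≤-reflexive (trans (s₂-step {1} n (s≤s (s≤s z≤n))) (cong suc (sym (s₂-step {0} n d<2))))
  step {1} n d<2 ih = begin
    s₂ (0 + suc n * 2)     ≡⟨ s₂-step {0} (suc n) z<s ⟩
    s₂ (suc n)             ≤⟨ ih ⟩
    suc (s₂ n)             ≡⟨ s₂-step {1} n d<2 ⟨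
    s₂ (1 + n * 2)         ≤⟨ n≤1+n _ ⟩
    suc (s₂ (1 + n * 2))   ∎
    where open ≤-Reasoning
  step {suc (suc _)} n (s≤s (s≤s ())) ih

s₂-≤ : ∀ n → s₂ n ≤ n
s₂-≤ zero    = z≤n
s₂-≤ (suc n) = ≤-trans (s₂-suc n) (s≤s (s₂-≤ n))

-- Two ones in a column are replaced by a single carry, and by `s₂-suc` absorbing a carry costs at
-- most one.
s₂-+ : ∀ a b → s₂ (a + b) ≤ s₂ a + s₂ b
s₂-+ = binary-ind (λ a → ∀ b → s₂ (a + b) ≤ s₂ a + s₂ b) (λ b → ≤-refl) step
  where
  open ≤-Reasoning
  carry : ∀ d e a b → d < 2 → e < 2 → (∀ b → s₂ (a + b) ≤ s₂ a + s₂ b) →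
          s₂ (d + e + (a + b) * 2) ≤ d + e + (s₂ a + s₂ b)
  carry 1 1 a b _ _ ih = begin
    s₂ (0 + suc (a + b) * 2)   ≡⟨ s₂-step {0} (suc (a + b)) z<s ⟩
    s₂ (suc (a + b))           ≤⟨ s₂-suc (a + b) ⟩
    suc (s₂ (a + b))           ≤⟨ s≤s (ih b) ⟩
    suc (s₂ a + s₂ b)          ≤⟨ n≤1+n _ ⟩
    2 + (s₂ a + s₂ b)          ∎
  carry 0 e a b _ e<2 ih = ≤-trans (≤-reflexive (s₂-step (a + b) e<2)) (+-monoʳ-≤ e (ih b))
  carry 1 0 a b d<2 _ ih = ≤-trans (≤-reflexive (s₂-step (a + b) d<2)) (+-monoʳ-≤ 1 (ih b))
  carry (suc (suc _)) _ _ _ (s≤s (s≤s ()))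
  carry 1 (suc (suc _)) _ _ _ (s≤s (s≤s ()))

  step : ∀ {d} a → d < 2 → (∀ b → s₂ (a + b) ≤ s₂ a + s₂ b) →
         ∀ b → s₂ (d + a * 2 + b) ≤ s₂ (d + a * 2) + s₂ b
  step {d} a d<2 ih b = begin
    s₂ (d + a * 2 + b)                        ≡⟨ cong (λ x → s₂ (d + a * 2 + x)) (≡%2+/2*2 b) ⟩
    s₂ (d + a * 2 + (b % 2 + b / 2 * 2))      ≡⟨ cong s₂ (regroup d a (b % 2) (b / 2)) ⟩
    s₂ (d + b % 2 + (a + b / 2) * 2)          ≤⟨ carry d (b % 2) a (b / 2) d<2 (m%n<n b 2) ih ⟩
    d + b % 2 + (s₂ a + s₂ (b / 2))           ≡⟨ +-interchange d (b % 2) (s₂ a) (s₂ (b / 2)) ⟩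
    (d + s₂ a) + (b % 2 + s₂ (b / 2))         ≡⟨ cong₂ _+_ (s₂-step a d<2) (s₂-%2+/2 b) ⟨
    s₂ (d + a * 2) + s₂ b                     ∎
    where
    open +-*-Solver
    regroup : ∀ d a e c → d + a * 2 + (e + c * 2) ≡ d + e + (a + c) * 2
    regroup = solve 4 (λ d a e c → d :+ a :* con 2 :+ (e :+ c :* con 2) := d :+ e :+ (a :+ c) :* con 2) refl
    +-interchange : ∀ d e a c → d + e + (a + c) ≡ (d + a) + (e + c)
    +-interchange = solve 4 (λ d e a c → d :+ e :+ (a :+ c) := (d :+ a) :+ (e :+ c)) refl

halve-< : ∀ {d} n {m} → d + n * 2 < 2 * m → n < m
halve-< {d} n {m} lt = *-cancelˡ-< 2 n m (≤-<-trans (≤-trans (≤-reflexive (*-comm 2 n)) (m≤n+m (n * 2) d)) lt)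

s₂-shift : ∀ ℓ {r} q → r < 2 ^ ℓ → s₂ (r + 2 ^ ℓ * q) ≡ s₂ r + s₂ q
s₂-shift zero    {zero}  q r<1 = cong s₂ (+-identityʳ q)
s₂-shift zero    {suc _} q (s≤s ())
s₂-shift (suc ℓ) {r}     q r<  = begin
  s₂ (r + 2 * 2 ^ ℓ * q)                     ≡⟨ cong (λ x → s₂ (x + 2 * 2 ^ ℓ * q)) (≡%2+/2*2 r) ⟩
  s₂ (r % 2 + r / 2 * 2 + 2 * 2 ^ ℓ * q)     ≡⟨ cong s₂ (regroup (r % 2) (r / 2) (2 ^ ℓ) q) ⟩
  s₂ (r % 2 + (r / 2 + 2 ^ ℓ * q) * 2)       ≡⟨ s₂-step (r / 2 + 2 ^ ℓ * q) (m%n<n r 2) ⟩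
  r % 2 + s₂ (r / 2 + 2 ^ ℓ * q)             ≡⟨ cong (r % 2 +_) (s₂-shift ℓ q r/2<) ⟩
  r % 2 + (s₂ (r / 2) + s₂ q)                ≡⟨ +-assoc (r % 2) _ _ ⟨
  r % 2 + s₂ (r / 2) + s₂ q                  ≡⟨ cong (_+ s₂ q) (s₂-%2+/2 r) ⟨
  s₂ r + s₂ q                                ∎
  where
  open ≡-Reasoning
  open +-*-Solver
  regroup : ∀ d r p q → d + r * 2 + 2 * p * q ≡ d + (r + p * q) * 2
  regroup = solve 4 (λ d r p q → d :+ r :* con 2 :+ con 2 :* p :* q := d :+ (r :+ p :* q) :* con 2) refl
  r/2< : r / 2 < 2 ^ ℓ
  r/2< = halve-< {r % 2} (r / 2) (subst (_< 2 ^ suc ℓ) (≡%2+/2*2 r) r<)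

s₂-≤-length : ∀ ℓ {r} → r < 2 ^ ℓ → s₂ r ≤ ℓ
s₂-≤-length zero    {zero}  _ = z≤n
s₂-≤-length zero    {suc _} (s≤s ())
s₂-≤-length (suc ℓ) {r}     r< = begin
  s₂ r                  ≡⟨ s₂-%2+/2 r ⟩
  r % 2 + s₂ (r / 2)    ≤⟨ +-mono-≤ (≤-pred (m%n<n r 2)) (s₂-≤-length ℓ (halve-< {r % 2} (r / 2) (subst (_< 2 ^ suc ℓ) (≡%2+/2*2 r) r<))) ⟩
  suc ℓ                 ∎
  where open ≤-Reasoning

s₂-positive : ∀ n → n > 0 → s₂ n > 0
s₂-positive = binary-ind (λ n → n > 0 → s₂ n > 0) (λ ()) step
  where
  step : ∀ {d} n → d < 2 → (n > 0 → s₂ n > 0) → d + n * 2 > 0 → s₂ (d + n * 2) > 0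
  step {zero}  zero        d<2 ih ()
  step {zero}  n@(suc _)   d<2 ih _ = subst (_> 0) (sym (s₂-step n d<2)) (ih z<s)
  step {suc d} n           d<2 ih _ = subst (_> 0) (sym (s₂-step n d<2)) z<s

-- Sturdiness from divisors of `2 ^ m ∸ 1`

∧-split : ∀ x {y} → T (x ∧ y) → T x × T y
∧-split x = Equivalence.to (T-∧ {x})

-- 2 ^ m ≡ 1 modulo d, so cutting X at digit m and adding the two parts preserves divisibility by d.
fold : ∀ m {d} .{{_ : NonZero m}} X → X > 0 → d ∣ X → d ∣ 2 ^ m ∸ 1 →
       ∃[ Y ] (Y > 0 × Y < 2 ^ m × d ∣ Y × s₂ Y ≤ s₂ X)
fold m {d} X X>0 d∣X d∣M = go X X>0 d∣X (<-wellFounded X)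
  where
  instance
    2^m≢0 : NonZero (2 ^ m)
    2^m≢0 = m^n≢0 2 m
  M = 2 ^ m ∸ 1
  1+M : suc M ≡ 2 ^ m
  1+M = m+[n∸m]≡n (m^n>0 2 m)
  M>0 : M > 0
  M>0 = m<n⇒0<n∸m (2≤2^ m)
    where
    2≤2^ : ∀ m .{{_ : NonZero m}} → 2 ≤ 2 ^ m
    2≤2^ (suc m) = *-monoʳ-≤ 2 (m^n>0 2 m)
  go : ∀ X → X > 0 → d ∣ X → Acc _<_ X → ∃[ Y ] (Y > 0 × Y < 2 ^ m × d ∣ Y × s₂ Y ≤ s₂ X)
  go X X>0 d∣X (acc rec) with X <? 2 ^ m
  ... | yes X<2^m = X , X>0 , X<2^m , d∣X , ≤-refl
  ... | no  X≮2^m =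
    let Y , Y>0 , Y< , d∣Y , sY = go (r + q) (≤-trans q>0 (m≤n+m q r)) d∣r+q (rec r+q<X)
    in  Y , Y>0 , Y< , d∣Y , ≤-trans sY (≤-trans (s₂-+ r q) (≤-reflexive (sym s₂-X)))
    where
    r = X % 2 ^ m
    q = X / 2 ^ m
    X≡ : X ≡ r + 2 ^ m * q
    X≡ = trans (m≡m%n+[m/n]*n X (2 ^ m)) (cong (r +_) (*-comm q (2 ^ m)))
    q>0 : q > 0
    q>0 = m≥n⇒m/n>0 (≮⇒≥ X≮2^m)
    -- The folded number `r + q` differs from `X` by `M * q`, which is a multiple of `d` and
    -- positive. This yields both the divisibility and the descent.
    X≡′ : X ≡ M * q + (r + q)
    X≡′ = trans X≡ (trans (cong (λ p → r + p * q) (sym 1+M)) (regroup r M q))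
      where
      open +-*-Solver
      regroup : ∀ r M q → r + (q + M * q) ≡ M * q + (r + q)
      regroup = solve 3 (λ r M q → r :+ (q :+ M :* q) := M :* q :+ (r :+ q)) refl
    d∣r+q : d ∣ r + q
    d∣r+q = ∣m+n∣m⇒∣n (subst (d ∣_) X≡′ d∣X) (∣m⇒∣m*n q d∣M)
    r+q<X : r + q < X
    r+q<X = subst (r + q <_) (sym X≡′) (m<n+m (r + q) (*-mono-≤ M>0 q>0))
    s₂-X : s₂ X ≡ s₂ r + s₂ q
    s₂-X = trans (cong s₂ X≡) (s₂-shift m q (m%n<n X (2 ^ m)))

-- The digits of t are chosen from the least significant one on; c is the carry and w the number of
-- ones still to be produced.
heavy : (d len c w : ℕ) → Bool
heavyNext : (d len x w : ℕ) → Bool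
heavy d len       c       zero          = true
-- With a positive carry the total is positive for every t and hence has a one; the branching stops
-- here.
heavy d len       (suc c) 1             = true
heavy d zero      c       w@(suc _)     = w ≤ᵇ s₂ c
heavy d (suc len) c       w@(suc _)     = heavyNext d len c w ∧ heavyNext d len (c + d) w
heavyNext d len x w = heavy d len (x / 2) (w ∸ x % 2)

heavy-sound : ∀ d len c w → T (heavy d len c w) → ∀ t → t < 2 ^ len → w ≤ s₂ (c + t * d)
heavyNext-sound : ∀ d len x w → T (heavyNext d len x w) → ∀ t → t < 2 ^ len → w ≤ s₂ (x + t * 2 * d)
heavyStep-sound : ∀ d len c w → T (heavyNext d len c w ∧ heavyNext d len (c + d) w) →
                  ∀ t → t < 2 ^ suc len → w ≤ s₂ (c + t * d)
heavy-sound d len       c       zero          h t t< = z≤n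
heavy-sound d zero      (suc c) 1             h t t< = s₂-positive (suc c + t * d) z<s
heavy-sound d (suc len) (suc c) 1             h t t< = s₂-positive (suc c + t * d) z<s
heavy-sound d zero      zero    w@(suc _)     h zero t< = ≤ᵇ⇒≤ w (s₂ 0) h
heavy-sound d zero      c@(suc c′) w@(suc (suc _)) h zero t< =
  subst (λ x → w ≤ s₂ x) (sym (+-identityʳ c)) (≤ᵇ⇒≤ w (s₂ c) h)
heavy-sound d zero      c       w             h (suc t) (s≤s ())
heavy-sound d (suc len) zero    w@(suc _)     h t t< = heavyStep-sound d len 0 w h t t<
heavy-sound d (suc len) c@(suc _) w@(suc (suc _)) h t t< = heavyStep-sound d len c w h t t<
heavyStep-sound d len c w h t t< with ∧-split (heavyNext d len c w) h | m%n<n t 2 | ≡%2+/2*2 t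
... | h0 , h1 | t%2<2 | t≡ with t % 2 | t / 2
... | 0 | t′ = subst (λ t → w ≤ s₂ (c + t * d)) (sym t≡)
      (heavyNext-sound d len c w h0 t′ (halve-< {0} t′ (subst (_< _) t≡ t<)))
... | 1 | t′ = subst (λ t → w ≤ s₂ (c + t * d)) (sym t≡)
      (subst (λ x → w ≤ s₂ x) (+-assoc c d (t′ * 2 * d))
        (heavyNext-sound d len (c + d) w h1 t′ (halve-< {1} t′ (subst (_< _) t≡ t<))))
heavyStep-sound d len c w h t t< | h0 , h1 | s≤s (s≤s ()) | t≡ | suc (suc _) | t′
heavyNext-sound d len x w h t t< = begin
  w                                          ≤⟨ m≤n+m∸n w (x % 2) ⟩
  x % 2 + (w ∸ x % 2)                        ≤⟨ +-monoʳ-≤ (x % 2) (heavy-sound d len (x / 2) (w ∸ x % 2) h t t<) ⟩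
  x % 2 + s₂ (x / 2 + t * d)                 ≡⟨ s₂-step (x / 2 + t * d) (m%n<n x 2) ⟨
  s₂ (x % 2 + (x / 2 + t * d) * 2)           ≡⟨ cong s₂ (regroup (x % 2) (x / 2) t d) ⟩
  s₂ (x % 2 + x / 2 * 2 + t * 2 * d)         ≡⟨ cong (λ y → s₂ (y + t * 2 * d)) (≡%2+/2*2 x) ⟨
  s₂ (x + t * 2 * d)                         ∎
  where
  open ≤-Reasoning
  open +-*-Solver
  regroup : ∀ r q t d → r + (q + t * d) * 2 ≡ r + q * 2 + t * 2 * d
  regroup = solve 4 (λ r q t d → r :+ (q :+ t :* d) :* con 2 := r :+ q :* con 2 :+ t :* con 2 :* d) refl

-- An even multiple has as many ones as its half, so only odd `t` need the search. Their lowest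
-- digit is fixed to 1, which is why it starts from `d` and handles one digit more than `len`.
heavy-multiples : ∀ d len w → T (heavyNext d len d w) → ∀ t → t > 0 → t < 2 ^ suc len → w ≤ s₂ (t * d)
heavy-multiples d len w h = binary-ind (λ t → t > 0 → t < 2 ^ suc len → w ≤ s₂ (t * d)) (λ ()) step
  where
  step : ∀ {e} t → e < 2 → (t > 0 → t < 2 ^ suc len → w ≤ s₂ (t * d)) →
         e + t * 2 > 0 → e + t * 2 < 2 ^ suc len → w ≤ s₂ ((e + t * 2) * d)
  step {0} zero    _ ih () _
  step {0} t@(suc _) _ ih _ t*2< =
    subst (w ≤_) (trans (sym (s₂-step {0} (t * d) z<s)) (cong s₂ (regroup t d)))
          (ih z<s (≤-<-trans (m≤m*n t 2) t*2<))
    where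
    open +-*-Solver
    regroup : ∀ t d → t * d * 2 ≡ t * 2 * d
    regroup = solve 2 (λ t d → t :* d :* con 2 := t :* con 2 :* d) refl
  step {1} t _ ih _ t*2< = heavyNext-sound d len d w h t (halve-< {1} t t*2<)
  step {suc (suc _)} t (s≤s (s≤s ())) ih _ _

sturdy-by-divisor : ∀ m {d} n .{{_ : NonZero m}} → n > 0 → d ∣ n → d ∣ 2 ^ m ∸ 1 →
  (∀ Y → Y > 0 → Y < 2 ^ m → d ∣ Y → s₂ n ≤ s₂ Y) → Sturdy n
sturdy-by-divisor m n n>0 d∣n d∣M bound (k , k>0 , flimsy) =
  let Y , Y>0 , Y< , d∣Y , sY = fold m (k * n) (*-mono-≤ k>0 n>0) (∣n⇒∣m*n k d∣n) d∣M
  in  <⇒≱ flimsy (≤-trans (bound Y Y>0 Y< d∣Y) sY)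

-- Nothing is proved about the result, and without fuel it is returned untested: every use evaluates
-- the required condition on it again.
least : (ℕ → Bool) → (fuel start : ℕ) → ℕ
least p zero       n = n
least p (suc fuel) n = if p n then n else least p fuel (suc n)

-- The third test ensures that factors of `suc len` digits reach all multiples of `d` below
-- `2 ^ suc m`; the exponent is written as a successor because folding needs it nonzero.
certificate : (n d m len : ℕ) → Bool
certificate n d m len =
  ⌊ d ∣? n ⌋ ∧ ⌊ d ∣? 2 ^ suc m ∸ 1 ⌋ ∧ (2 ^ suc m ≤ᵇ 2 ^ suc len * d) ∧ heavyNext d len d (s₂ n)

certificate-sound : ∀ n d m len → n > 0 → T (certificate n d m len) → Sturdy n
certificate-sound n d m len n>0 h
  with h₁ , h₂₃₄ ← ∧-split ⌊ d ∣? n ⌋ h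
  with h₂ , h₃₄  ← ∧-split ⌊ d ∣? 2 ^ suc m ∸ 1 ⌋ h₂₃₄
  with h₃ , h₄   ← ∧-split (2 ^ suc m ≤ᵇ 2 ^ suc len * d) h₃₄ =
  sturdy-by-divisor (suc m) n n>0 (toWitness h₁) (toWitness h₂) bound
  where
  bound : ∀ Y → Y > 0 → Y < 2 ^ suc m → d ∣ Y → s₂ n ≤ s₂ Y
  bound .(t * d) td>0 td< (divides-refl t) =
    heavy-multiples d len (s₂ n) h₄ t (n≢0⇒n>0 λ {refl → n≮0 td>0})
      (*-cancelʳ-< d t (2 ^ suc len) (<-≤-trans td< (≤ᵇ⇒≤ (2 ^ suc m) (2 ^ suc len * d) h₃)))

-- The multiplicative order of 2 modulo d is suc (orderIndex d).
orderIndex : ℕ → ℕ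
orderIndex d = least (λ m → ⌊ d ∣? 2 ^ suc m ∸ 1 ⌋) 100 0

quotientLength : ℕ → ℕ → ℕ
quotientLength d m = least (λ len → 2 ^ suc m ≤ᵇ 2 ^ suc len * d) 100 0

certifies : ℕ → ℕ → Bool
certifies n d = certificate n d (orderIndex d) (quotientLength d (orderIndex d))

-- Replacing `n` by a divisor demands the bound for more multiples, but a divisor with a smaller
-- order leaves a shorter range to inspect. The number itself is the last candidate.
allCertified : (moduli ns : List ℕ) → Bool
allCertified moduli = all (λ n → (0 <ᵇ n) ∧ any (certifies n) (moduli ++ [ n ]))

allCertified-sound : ∀ moduli ns → T (allCertified moduli ns) → ∀ {n} → n ∈ ns → Sturdy n
allCertified-sound moduli ns h {n} n∈ns =
  let h₁ , h₂ = ∧-split (0 <ᵇ n) (All.lookup (All.all⁺ _ ns h) n∈ns)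
      d , h₃  = satisfied (any⁻ (certifies n) (moduli ++ [ n ]) h₂)
  in  certificate-sound n d (orderIndex d) (quotientLength d (orderIndex d)) (<ᵇ⇒< 0 n h₁) h₃

-- Mersenne numbers and the complementary form

s₂-mersenne : ∀ m {M} → suc M ≡ 2 ^ m → s₂ M ≡ m
s₂-mersenne zero    {zero}  eq = refl
s₂-mersenne (suc m) {M} eq with M % 2 | M / 2 | m%n<n M 2 | ≡%2+/2*2 M
... | 0 | M′ | _ | refl = contradiction (sym (trans (cong suc (*-comm 2 M′)) eq)) (even≢odd (2 ^ m) M′)
... | 1 | M′ | _ | refl = trans (s₂-step {1} M′ (s≤s (s≤s z≤n)))
      (cong suc (s₂-mersenne m (*-cancelʳ-≡ (suc M′) (2 ^ m) 2 (trans eq (*-comm 2 (2 ^ m))))))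
... | suc (suc _) | _ | s≤s (s≤s ()) | _

-- After folding, the only positive multiple of `M` below `2 ^ m` is `M` itself, which has `m` ones;
-- no search is involved.
sturdy-by-mersenne : ∀ m {M} n .{{_ : NonZero m}} → n > 0 → suc M ≡ 2 ^ m → M ∣ n → s₂ n ≤ m → Sturdy n
sturdy-by-mersenne m {M} n n>0 1+M M∣n s₂n≤m =
  sturdy-by-divisor m n n>0 M∣n (subst (M ∣_) (cong pred 1+M) ∣-refl) bound
  where
  bound : ∀ Y → Y > 0 → Y < 2 ^ m → M ∣ Y → s₂ n ≤ s₂ Y
  bound Y@(suc _) Y>0 Y< M∣Y = subst (λ Y → s₂ n ≤ s₂ Y) M≡Y (≤-trans s₂n≤m (≤-reflexive (sym (s₂-mersenne m 1+M))))
    where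
    M≡Y : M ≡ Y
    M≡Y = ≤-antisym (∣⇒≤ M∣Y) (≤-pred (subst (Y <_) (sym 1+M) Y<))

zeros≡0⇒mersenne : ∀ n → n > 0 → zeros n ≡ 0 → suc n ≡ 2 ^ s₂ n
zeros≡0⇒mersenne = binary-ind _ (λ ()) step
  where
  step : ∀ {d} n → d < 2 → (n > 0 → zeros n ≡ 0 → suc n ≡ 2 ^ s₂ n) →
         d + n * 2 > 0 → zeros (d + n * 2) ≡ 0 → suc (d + n * 2) ≡ 2 ^ s₂ (d + n * 2)
  step {0} zero      _   ih () z
  step {1} zero      _   ih _ z = refl
  step {0} n@(suc _) d<2 ih _ z with trans (+-comm 1 (zeros n)) (trans (sym (zeros-step 0 n z<s d<2)) z)
  ... | ()
  step {1} n@(suc _) d<2 ih _ z = begin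
    suc n * 2            ≡⟨ cong (_* 2) (ih z<s (trans (sym (+-identityʳ _)) (trans (sym (zeros-step 1 n z<s d<2)) z))) ⟩
    2 ^ s₂ n * 2         ≡⟨ *-comm (2 ^ s₂ n) 2 ⟩
    2 ^ suc (s₂ n)       ≡⟨ cong (2 ^_) (s₂-step n d<2) ⟨
    2 ^ s₂ (1 + n * 2)   ∎
    where open ≡-Reasoning
  step {suc (suc _)} n (s≤s (s≤s ())) ih _ z

zeros≡0⇒sturdy : ∀ n → n > 0 → zeros n ≡ 0 → Sturdy n
zeros≡0⇒sturdy n n>0 z =
  sturdy-by-mersenne (s₂ n) n {{>-nonZero (s₂-positive n n>0)}} n>0 (zeros≡0⇒mersenne n n>0 z) ∣-refl ≤-refl

append : ℕ → List ℕ → ℕ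
append n []       = n
append n (d ∷ ds) = append (d + n * 2) ds

Bits : List ℕ → Set
Bits = All (_< 2)

binary-append : ∀ {ds} n → Bits ds → n > 0 → binary (append n ds) ≡ binary n ++ ds
binary-append n All.[]                    n>0 = sym (++-identityʳ (binary n))
binary-append n (All._∷_ {d} {ds} d<2 bs) n>0 = begin
  binary (append (d + n * 2) ds)   ≡⟨ binary-append (d + n * 2) bs (≤-trans (*-mono-≤ n>0 (s≤s {n = 1} z≤n)) (m≤n+m (n * 2) d)) ⟩
  binary (d + n * 2) ++ ds         ≡⟨ cong (_++ ds) (binary-step n d<2 n>0) ⟩
  (binary n ++ [ d ]) ++ ds        ≡⟨ ++-assoc (binary n) [ d ] ds ⟩
  binary n ++ d ∷ ds               ∎
  where open ≡-Reasoning

append-++ : ∀ n ds es → append n (ds ++ es) ≡ append (append n ds) es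
append-++ n []       es = refl
append-++ n (d ∷ ds) es = append-++ (d + n * 2) ds es

binary-bits : ∀ n → Bits (binary n) × append 0 (binary n) ≡ n
binary-bits = binary-ind _ (s≤s z≤n All.∷ All.[] , refl) step
  where
  step : ∀ {d} n → d < 2 → Bits (binary n) × append 0 (binary n) ≡ n →
         Bits (binary (d + n * 2)) × append 0 (binary (d + n * 2)) ≡ d + n * 2
  step {0} zero      d<2 ih = s≤s z≤n All.∷ All.[] , refl
  step {1} zero      d<2 ih = s≤s (s≤s z≤n) All.∷ All.[] , refl
  step {suc (suc _)} zero (s≤s (s≤s ())) ih
  step {d} n@(suc _) d<2 (bs , val) rewrite binary-step n d<2 z<s =
    All.++⁺ bs (d<2 All.∷ All.[]) , trans (append-++ 0 (binary n) [ d ]) (cong (λ n → d + n * 2) val)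

append-ones : ∀ n i → suc (append n (replicate i 1)) ≡ suc n * 2 ^ i
append-ones n zero    = sym (*-identityʳ (suc n))
append-ones n (suc i) = trans (append-ones (1 + n * 2) i) (*-assoc (suc n) 2 (2 ^ i))

-- Each column adds a digit to its complement, so there is no carry and the sum is `a + b` followed
-- by ones only. One more unit turns these ones into zeros.
append-complement : ∀ a b {ds} → Bits ds →
                    suc (append a (complement ds) + append b ds) ≡ suc (a + b) * 2 ^ length ds
append-complement a b All.[]                    = sym (*-identityʳ _)
append-complement a b (All._∷_ {d} {ds} d<2 bs) = begin
  suc (append (1 ∸ d + a * 2) (complement ds) + append (d + b * 2) ds)
    ≡⟨ append-complement (1 ∸ d + a * 2) (d + b * 2) bs ⟩
  suc ((1 ∸ d + a * 2) + (d + b * 2)) * 2 ^ length ds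
    ≡⟨ cong (λ x → suc x * 2 ^ length ds) (regroup (1 ∸ d) d a b) ⟩
  suc ((1 ∸ d + d) + (a + b) * 2) * 2 ^ length ds
    ≡⟨ cong (λ x → suc (x + (a + b) * 2) * 2 ^ length ds) (m∸n+n≡m (≤-pred d<2)) ⟩
  suc (a + b) * 2 * 2 ^ length ds
    ≡⟨ *-assoc (suc (a + b)) 2 (2 ^ length ds) ⟩
  suc (a + b) * (2 * 2 ^ length ds) ∎
  where
  open ≡-Reasoning
  open +-*-Solver
  regroup : ∀ c d a b → (c + a * 2) + (d + b * 2) ≡ (c + d) + (a + b) * 2
  regroup = solve 4 (λ c d a b → (c :+ a :* con 2) :+ (d :+ b :* con 2) := (c :+ d) :+ (a :+ b) :* con 2) refl

complement-bits : ∀ {ds} → Bits ds → Bits (complement ds)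
complement-bits All.[]                  = All.[]
complement-bits (All._∷_ {d} _ bs) = s≤s (m∸n≤m 1 d) All.∷ complement-bits bs

sum-complement : ∀ {ds} → Bits ds → sum ds + sum (complement ds) ≡ length ds
sum-complement All.[]                    = refl
sum-complement (All._∷_ {d} {ds} d<2 bs) = begin
  d + sum ds + (1 ∸ d + sum (complement ds))       ≡⟨ regroup d (sum ds) (1 ∸ d) _ ⟩
  d + (1 ∸ d) + (sum ds + sum (complement ds))     ≡⟨ cong₂ _+_ (m+[n∸m]≡n (≤-pred d<2)) (sum-complement bs) ⟩
  suc (length ds)                                  ∎
  where
  open ≡-Reasoning
  open +-*-Solver
  regroup : ∀ d s c t → d + s + (c + t) ≡ d + c + (s + t)
  regroup = solve 4 (λ d s c t → d :+ s :+ (c :+ t) := d :+ c :+ (s :+ t)) refl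

replicate-bits : ∀ i → Bits (replicate i 1)
replicate-bits i = All.replicate⁺ i (s≤s (s≤s z≤n))

sum-ones : ∀ i → sum (replicate i 1) ≡ i
sum-ones zero    = refl
sum-ones (suc i) = cong suc (sum-ones i)

module _ (x i : ℕ) where
  private
    L = length (binary x)

  complementaryValue : ∀ {n} → n ≡ append x (replicate i 1 ++ complement (binary x)) →
                       suc (n + x) ≡ suc x * 2 ^ (i + L)
  complementaryValue refl = begin
    suc (append x (replicate i 1 ++ complement (binary x)) + x)
      ≡⟨ cong₂ (λ n x → suc (n + x)) (append-++ x (replicate i 1) (complement (binary x))) (sym (proj₂ (binary-bits x))) ⟩
    suc (append a (complement (binary x)) + append 0 (binary x))
      ≡⟨ append-complement a 0 (proj₁ (binary-bits x)) ⟩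
    suc (a + 0) * 2 ^ L                      ≡⟨ cong (λ a → suc a * 2 ^ L) (+-identityʳ a) ⟩
    suc a * 2 ^ L                            ≡⟨ cong (_* 2 ^ L) (append-ones x i) ⟩
    suc x * 2 ^ i * 2 ^ L                    ≡⟨ *-assoc (suc x) (2 ^ i) (2 ^ L) ⟩
    suc x * (2 ^ i * 2 ^ L)                  ≡⟨ cong (suc x *_) (^-distribˡ-+-* 2 i L) ⟨
    suc x * 2 ^ (i + L)                      ∎
    where
    open ≡-Reasoning
    a = append x (replicate i 1)

length-binary : ∀ x s → x > 0 → x < 2 ^ s → length (binary x) ≤ s
length-binary = binary-ind _ (λ s ()) step
  where
  step : ∀ {d} n → d < 2 → (∀ s → n > 0 → n < 2 ^ s → length (binary n) ≤ s) →
         ∀ s → d + n * 2 > 0 → d + n * 2 < 2 ^ s → length (binary (d + n * 2)) ≤ s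
  step {d}     n         d<2 ih zero    x>0 x<1 = contradiction-< x>0 x<1
    where
    contradiction-< : ∀ {x} {A : Set} → x > 0 → x < 1 → A
    contradiction-< {suc _} _ (s≤s ())
  step {0}     zero      d<2 ih (suc s) ()  x<
  step {1}     zero      d<2 ih (suc s) x>0 x< = s≤s z≤n
  step {suc (suc _)} zero (s≤s (s≤s ())) ih (suc s) x>0 x<
  step {d}     n@(suc _) d<2 ih (suc s) x>0 x< = begin
    length (binary (d + n * 2))      ≡⟨ cong length (binary-step n d<2 z<s) ⟩
    length (binary n ++ [ d ])       ≡⟨ length-++ (binary n) ⟩
    length (binary n) + 1            ≡⟨ +-comm (length (binary n)) 1 ⟩
    suc (length (binary n))          ≤⟨ s≤s (ih s z<s (halve-< {d} n x<)) ⟩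
    suc s                            ∎
    where open ≤-Reasoning

-- For given `x` and `s` the equation has a single solution `n`, so it is enough that `x 1ⁱ x̄`
-- satisfies it too. The bound `x < 2 ^ s` makes `s ∸ length (binary x)` an exact difference.
complementary : ∀ n x s → x > 0 → x < 2 ^ s → suc (n + x) ≡ suc x * 2 ^ s →
                OnesBetween (binary x) (complement (binary x)) n
complementary n x s x>0 x< eq = i , trans (cong binary n≡) (binary-append x bits x>0)
  where
  i = s ∸ length (binary x)
  bits : Bits (replicate i 1 ++ complement (binary x))
  bits = All.++⁺ (replicate-bits i) (complement-bits (proj₁ (binary-bits x)))
  n≡ : n ≡ append x (replicate i 1 ++ complement (binary x))
  n≡ = +-cancelʳ-≡ x n _ (suc-injective (trans eq (sym (trans (complementaryValue x i refl)
         (cong (λ s → suc x * 2 ^ s) (m∸n+n≡m (length-binary x s x>0 x<)))))))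

binary-length>0 : ∀ n → length (binary n) > 0
binary-length>0 = binary-ind _ z<s step
  where
  step : ∀ {d} n → d < 2 → length (binary n) > 0 → length (binary (d + n * 2)) > 0
  step {0} zero d<2 ih = z<s
  step {1} zero d<2 ih = z<s
  step {suc (suc _)} zero (s≤s (s≤s ())) ih
  step {d} n@(suc _) d<2 ih rewrite binary-step n d<2 z<s | length-++ (binary n) {[ d ]} =
    m≤n⇒m≤n+o 1 ih

complementary⇒sturdy : ∀ {n} x → x > 0 → OnesBetween (binary x) (complement (binary x)) n → Sturdy n
complementary⇒sturdy {n} x x>0 (i , eq) =
  sturdy-by-mersenne s n {{>-nonZero s>0}} n>0 (1+M) (divides (suc x) n≡) (≤-reflexive s₂n)
  where
  L = length (binary x)
  s = i + L
  s>0 : s > 0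
  s>0 = ≤-trans (binary-length>0 x) (m≤n+m L i)
  M = 2 ^ s ∸ 1
  1+M : suc M ≡ 2 ^ s
  1+M = m+[n∸m]≡n (m^n>0 2 s)
  value : n ≡ append x (replicate i 1 ++ complement (binary x))
  value = begin
    n                                                             ≡⟨ proj₂ (binary-bits n) ⟨
    append 0 (binary n)                                           ≡⟨ cong (append 0) eq ⟩
    append 0 (binary x ++ replicate i 1 ++ complement (binary x)) ≡⟨ append-++ 0 (binary x) _ ⟩
    append (append 0 (binary x)) (replicate i 1 ++ complement (binary x))
      ≡⟨ cong (λ x′ → append x′ (replicate i 1 ++ complement (binary x))) (proj₂ (binary-bits x)) ⟩
    append x (replicate i 1 ++ complement (binary x))             ∎
    where open ≡-Reasoning
  n≡ : n ≡ suc x * M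
  n≡ = +-cancelʳ-≡ (suc x) n (suc x * M) (begin
    n + suc x                ≡⟨ +-suc n x ⟩
    suc (n + x)              ≡⟨ complementaryValue x i value ⟩
    suc x * 2 ^ s            ≡⟨ cong (suc x *_) 1+M ⟨
    suc x * suc M            ≡⟨ *-suc (suc x) M ⟩
    suc x + suc x * M        ≡⟨ +-comm (suc x) _ ⟩
    suc x * M + suc x        ∎)
    where open ≡-Reasoning
  n>0 : n > 0
  n>0 = subst (_> 0) (sym n≡) (*-mono-≤ {1} {suc x} {1} {M} (s≤s z≤n) (m<n⇒0<n∸m (2≤ s>0)))
    where
    2≤ : ∀ {s} → s > 0 → 2 ≤ 2 ^ s
    2≤ {suc s} _ = *-monoʳ-≤ 2 (m^n>0 2 s)
  s₂n : s₂ n ≡ s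
  s₂n = begin
    sum (binary n)                                                          ≡⟨ cong sum eq ⟩
    sum (binary x ++ replicate i 1 ++ complement (binary x))                ≡⟨ sum-++ (binary x) _ ⟩
    s₂ x + sum (replicate i 1 ++ complement (binary x))                     ≡⟨ cong (s₂ x +_) (sum-++ (replicate i 1) _) ⟩
    s₂ x + (sum (replicate i 1) + sum (complement (binary x)))              ≡⟨ cong (λ j → s₂ x + (j + sum (complement (binary x)))) (sum-ones i) ⟩
    s₂ x + (i + sum (complement (binary x)))                                ≡⟨ regroup (s₂ x) i _ ⟩
    i + (s₂ x + sum (complement (binary x)))                                ≡⟨ cong (i +_) (sum-complement (proj₁ (binary-bits x))) ⟩
    i + L                                                                   ∎
    where
    open ≡-Reasoning
    open +-*-Solver
    regroup : ∀ a b c → a + (b + c) ≡ b + (a + c)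
    regroup = solve 3 (λ a b c → a :+ (b :+ c) := b :+ (a :+ c)) refl

-- Digit patterns with runs of arbitrary length

-- ⋆ stands for an arbitrary run of ones.  A list of tokens starts with the most significant one, that
-- is, with the one read last.
data Token : Set where
  𝟘 𝟙 ⋆ : Token

data Denotes : List Token → (n ℓ : ℕ) → Set where
  []     : Denotes [] 0 0
  𝟘      : ∀ {P n ℓ} → Denotes P n ℓ → Denotes (𝟘 ∷ P) n (suc ℓ)
  𝟙      : ∀ {P n ℓ} → Denotes P n ℓ → Denotes (𝟙 ∷ P) (n + 2 ^ ℓ) (suc ℓ)
  ⋆-stop : ∀ {P n ℓ} → Denotes P n ℓ → Denotes (⋆ ∷ P) n ℓ
  ⋆-more : ∀ {P n ℓ} → Denotes (⋆ ∷ P) n ℓ → Denotes (⋆ ∷ P) (n + 2 ^ ℓ) (suc ℓ)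

-- A nonempty run has its lowest one written out and stays arbitrary above it. Repeated expansion
-- therefore separates the short runs, as fixed digits, from those beyond a growing minimal length.
expand : List Token → List (List Token)
expand []      = [ [] ]
expand (𝟘 ∷ P) = map (𝟘 ∷_) (expand P)
expand (𝟙 ∷ P) = map (𝟙 ∷_) (expand P)
expand (⋆ ∷ P) = expand P ++ map (λ Q → ⋆ ∷ 𝟙 ∷ Q) (expand P)

expand-sound : ∀ {P n ℓ} → Denotes P n ℓ → Any (λ Q → Denotes Q n ℓ) (expand P)
expand-sound []         = here []
expand-sound (𝟘 d)      = map⁺ (Any.map 𝟘 (expand-sound d))
expand-sound (𝟙 d)      = map⁺ (Any.map 𝟙 (expand-sound d))
expand-sound (⋆-stop d) = ++⁺ˡ (expand-sound d)
expand-sound {⋆ ∷ P} (⋆-more d) = ++⁺ʳ (expand P) (map⁺ (nonempty d))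
  where
  nonempty : ∀ {P n ℓ} → Denotes (⋆ ∷ P) n ℓ →
             Any (λ Q → Denotes (⋆ ∷ 𝟙 ∷ Q) (n + 2 ^ ℓ) (suc ℓ)) (expand P)
  nonempty (⋆-stop d) = Any.map (λ e → ⋆-stop (𝟙 e)) (expand-sound d)
  nonempty (⋆-more d) = Any.map ⋆-more (nonempty d)

-- segment v ℓ p Q: the low ℓ digits have value v, then comes a run of ones of arbitrary length, then Q;
-- p caches 2 ^ ℓ.
data Pattern : Set where
  end     : (v ℓ : ℕ) → Pattern
  segment : (v ℓ p : ℕ) → Pattern → Pattern

data Matches : Pattern → (n ℓ : ℕ) → Set
data MatchesOnes (Q : Pattern) : (n ℓ : ℕ) → Set

data Matches where
  end     : ∀ {v ℓ n m} → n ≡ v → m ≡ ℓ → Matches (end v ℓ) n m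
  segment : ∀ {v ℓ p Q n m w m′} → p ≡ 2 ^ ℓ → n ≡ v + p * w → m ≡ ℓ + m′ →
            MatchesOnes Q w m′ → Matches (segment v ℓ p Q) n m

data MatchesOnes Q where
  stop : ∀ {n ℓ} → Matches Q n ℓ → MatchesOnes Q n ℓ
  more : ∀ {n ℓ} → MatchesOnes Q n ℓ → MatchesOnes Q (1 + n * 2) (suc ℓ)

low : ℕ → Pattern → Pattern
low d (end v ℓ)         = end (d + v * 2) (suc ℓ)
low d (segment v ℓ p Q) = segment (d + v * 2) (suc ℓ) (2 * p) Q

compile : List Token → Pattern → Pattern
compile []      Q = Q
compile (𝟘 ∷ P) Q = compile P (low 0 Q)
compile (𝟙 ∷ P) Q = compile P (low 1 Q)
compile (⋆ ∷ P) Q = compile P (segment 0 0 1 Q)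

low-matches : ∀ d {Q n ℓ} → Matches Q n ℓ → Matches (low d Q) (d + n * 2) (suc ℓ)
low-matches d (end refl refl) = end refl refl
low-matches d (segment {v} {p = p} {w = w} refl refl refl o) = segment refl (regroup d v p w) refl o
  where
  open +-*-Solver
  regroup : ∀ d v p w → d + (v + p * w) * 2 ≡ d + v * 2 + (2 * p) * w
  regroup = solve 4 (λ d v p w → d :+ (v :+ p :* w) :* con 2 := d :+ v :* con 2 :+ (con 2 :* p) :* w) refl

compile-sound : ∀ {P Q v ℓ w m} → Denotes P v ℓ → Matches Q w m →
                Matches (compile P Q) (v + 2 ^ ℓ * w) (ℓ + m)
-- `⋆-more` puts ones on top of a run and `more` puts them below. The ones are taken off the first
-- description from the top and handed to the second.
compile-sound⋆ : ∀ {P Q v ℓ w m} → Denotes (⋆ ∷ P) v ℓ → MatchesOnes Q w m →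
                 Matches (compile P (segment 0 0 1 Q)) (v + 2 ^ ℓ * w) (ℓ + m)
shift-low : ∀ v ℓ d w → v + 2 ^ ℓ * (d + w * 2) ≡ v + d * 2 ^ ℓ + 2 ^ suc ℓ * w
shift-low v ℓ d w = solve 4 (λ v p d w → v :+ p :* (d :+ w :* con 2) := v :+ d :* p :+ (con 2 :* p) :* w) refl v (2 ^ ℓ) d w
  where open +-*-Solver
compile-sound {Q = Q} {w = w} {m} [] q = subst (λ n → Matches Q n m) (sym (+-identityʳ w)) q
compile-sound {_ ∷ P} {Q} {w = w} {m} (𝟘 {n = v} {ℓ} d) q =
  subst₂ (Matches (compile P (low 0 Q)))
         (trans (shift-low v ℓ 0 w) (cong (_+ 2 ^ suc ℓ * w) (+-identityʳ v))) (+-suc ℓ m)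
         (compile-sound d (low-matches 0 q))
compile-sound {_ ∷ P} {Q} {w = w} {m} (𝟙 {n = v} {ℓ} d) q =
  subst₂ (Matches (compile P (low 1 Q)))
         (trans (shift-low v ℓ 1 w) (cong (λ p → v + p + 2 ^ suc ℓ * w) (+-identityʳ (2 ^ ℓ)))) (+-suc ℓ m)
         (compile-sound d (low-matches 1 q))
compile-sound (⋆-stop d) q = compile-sound⋆ (⋆-stop d) (stop q)
compile-sound (⋆-more d) q = compile-sound⋆ (⋆-more d) (stop q)
compile-sound⋆ {w = w} (⋆-stop d) o =
  compile-sound d (segment refl (sym (+-identityʳ w)) refl o)
compile-sound⋆ {P} {Q} {w = w} {m} (⋆-more {n = v} {ℓ} d) o =
  subst₂ (Matches (compile P (segment 0 0 1 Q)))
         (trans (shift-low v ℓ 1 w) (cong (λ p → v + p + 2 ^ suc ℓ * w) (+-identityʳ (2 ^ ℓ)))) (+-suc ℓ m)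
         (compile-sound⋆ d (more o))

-- Testing one multiplier on a whole pattern

-- Working in base 16 takes a quarter of the divisions that single digits would take. The last
-- clause is exact for 0 and 1 and still an upper bound beyond the table.
nibbleWeight : ℕ → ℕ
nibbleWeight 2  = 1
nibbleWeight 3  = 2
nibbleWeight 4  = 1
nibbleWeight 5  = 2
nibbleWeight 6  = 2
nibbleWeight 7  = 3
nibbleWeight 8  = 1
nibbleWeight 9  = 2
nibbleWeight 10 = 2
nibbleWeight 11 = 3
nibbleWeight 12 = 2
nibbleWeight 13 = 3
nibbleWeight 14 = 3
nibbleWeight 15 = 4
nibbleWeight n  = n

s₂≤nibbleWeight : ∀ n → s₂ n ≤ nibbleWeight n
s₂≤nibbleWeight 0  = ≤-refl
s₂≤nibbleWeight 1  = ≤-refl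
s₂≤nibbleWeight 2  = ≤-refl
s₂≤nibbleWeight 3  = ≤-refl
s₂≤nibbleWeight 4  = ≤-refl
s₂≤nibbleWeight 5  = ≤-refl
s₂≤nibbleWeight 6  = ≤-refl
s₂≤nibbleWeight 7  = ≤-refl
s₂≤nibbleWeight 8  = ≤-refl
s₂≤nibbleWeight 9  = ≤-refl
s₂≤nibbleWeight 10 = ≤-refl
s₂≤nibbleWeight 11 = ≤-refl
s₂≤nibbleWeight 12 = ≤-refl
s₂≤nibbleWeight 13 = ≤-refl
s₂≤nibbleWeight 14 = ≤-refl
s₂≤nibbleWeight 15 = ≤-refl
s₂≤nibbleWeight n@(suc (suc (suc (suc (suc (suc (suc (suc (suc (suc (suc (suc (suc (suc (suc (suc _)))))))))))))))) = s₂-≤ n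

-- Only an upper bound of s₂ once the fuel is used up.
weight : (fuel n : ℕ) → ℕ
weight zero       n         = n
weight (suc fuel) zero      = zero
weight (suc fuel) n@(suc _) = nibbleWeight (n % 16) + weight fuel (n / 16)

s₂≤weight : ∀ fuel n → s₂ n ≤ weight fuel n
s₂≤weight zero       n         = s₂-≤ n
s₂≤weight (suc fuel) zero      = ≤-refl
s₂≤weight (suc fuel) n@(suc _) = begin
  s₂ n                                                 ≡⟨ cong s₂ (trans (m≡m%n+[m/n]*n n 16) (cong (n % 16 +_) (*-comm (n / 16) 16))) ⟩
  s₂ (n % 16 + 2 ^ 4 * (n / 16))                       ≡⟨ s₂-shift 4 (n / 16) (m%n<n n 16) ⟩
  s₂ (n % 16) + s₂ (n / 16)                            ≤⟨ +-mono-≤ (s₂≤nibbleWeight (n % 16)) (s₂≤weight fuel (n / 16)) ⟩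
  nibbleWeight (n % 16) + weight fuel (n / 16)         ∎
  where open ≤-Reasoning

-- Ones of the product grow with the runs, whereas the number of zeros it must show does not; hence
-- the balance is kept in zeros.
spend : (bit deficit : ℕ) → ℕ
spend zero    m = pred m
spend (suc _) m = m

spend-≤ : ∀ {b} m → b < 2 → b + m ≤ suc (spend b m)
spend-≤ {0} zero    _ = z≤n
spend-≤ {0} (suc m) _ = ≤-refl
spend-≤ {1} m       _ = ≤-refl
spend-≤ {suc (suc _)} m (s≤s (s≤s ()))

-- Total versions, so that a pattern need not carry a proof that its cached power is nonzero.
-- Soundness only meets `p ≡ 2 ^ ℓ`, which excludes the value 0.
quot rem : (n p : ℕ) → ℕ
quot n zero      = n
quot n p@(suc _) = n / p
rem  n zero      = n
rem  n p@(suc _) = n % p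

-- Keeps the deficit m of kill positive, since truncated subtraction at 0 would lose information.
slack : ℕ
slack = 24

-- kill k c m Q checks s₂ (c + k * n) + m ≤ L + slack for all n of length L matching Q.
kill : (k c m : ℕ) → Pattern → Bool
killAfter : (k m ℓ p x : ℕ) → Pattern → Bool
killOnes : (k fuel c m : ℕ) → Pattern → Bool
kill k c m (end v ℓ)         = weight 20 (c + k * v) + m ≤ᵇ ℓ + slack
kill k c m (segment v ℓ p Q) = killAfter k m ℓ p (c + k * v) Q
-- Each one halves `k ∸ c`, rounding up, until it is 1. The largest multiplier tried, 261633, is
-- below `2 ^ 18`, so a fuel of 20 reaches saturation.
killAfter k m ℓ p x Q = killOnes k 20 (quot x p) (m ∸ (ℓ ∸ weight 20 (rem x p))) Q
killOnes k zero       c m Q = false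
killOnes k (suc fuel) c m Q =
  -- The first conjunct treats the run as ending here. At saturation it settles all longer runs too,
  -- since a further one adds 1 both to the digit sum and to the length.
  kill k c m Q ∧ (if suc c ≡ᵇ k then true else killOnes k fuel ((c + k) / 2) (spend ((c + k) % 2) m) Q)

s₂-digit : ∀ k x w → s₂ (x + k * (w * 2)) ≡ x % 2 + s₂ (x / 2 + k * w)
s₂-digit k x w = begin
  s₂ (x + k * (w * 2))                       ≡⟨ cong (λ y → s₂ (y + k * (w * 2))) (≡%2+/2*2 x) ⟩
  s₂ (x % 2 + x / 2 * 2 + k * (w * 2))       ≡⟨ cong s₂ (regroup (x % 2) (x / 2) k w) ⟩
  s₂ (x % 2 + (x / 2 + k * w) * 2)           ≡⟨ s₂-step (x / 2 + k * w) (m%n<n x 2) ⟩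
  x % 2 + s₂ (x / 2 + k * w)                 ∎
  where
  open ≡-Reasoning
  open +-*-Solver
  regroup : ∀ r q k w → r + q * 2 + k * (w * 2) ≡ r + (q + k * w) * 2
  regroup = solve 4 (λ r q k w → r :+ q :* con 2 :+ k :* (w :* con 2) := r :+ (q :+ k :* w) :* con 2) refl

spend-sound : ∀ k x m w {L} → s₂ (x / 2 + k * w) + spend (x % 2) m ≤ L →
              s₂ (x + k * (w * 2)) + m ≤ suc L
spend-sound k x m w {L} h = begin
  s₂ (x + k * (w * 2)) + m                      ≡⟨ cong (_+ m) (s₂-digit k x w) ⟩
  x % 2 + s₂ (x / 2 + k * w) + m                ≡⟨ regroup (x % 2) (s₂ (x / 2 + k * w)) m ⟩
  s₂ (x / 2 + k * w) + (x % 2 + m)              ≤⟨ +-monoʳ-≤ (s₂ (x / 2 + k * w)) (spend-≤ m (m%n<n x 2)) ⟩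
  s₂ (x / 2 + k * w) + suc (spend (x % 2) m)    ≡⟨ +-suc _ _ ⟩
  suc (s₂ (x / 2 + k * w) + spend (x % 2) m)    ≤⟨ s≤s h ⟩
  suc L                                         ∎
  where
  open ≤-Reasoning
  open +-*-Solver
  regroup : ∀ a b c → a + b + c ≡ b + (a + c)
  regroup = solve 3 (λ a b c → a :+ b :+ c := b :+ (a :+ c)) refl

read-one : ∀ c k w → c + k * (1 + w * 2) ≡ c + k + k * (w * 2)
read-one c k w = solve 3 (λ c k w → c :+ k :* (con 1 :+ w :* con 2) := c :+ k :+ k :* (w :* con 2)) refl c k w
  where open +-*-Solver

saturated : ∀ c w → s₂ (c + suc c * (1 + w * 2)) ≡ suc (s₂ (c + suc c * w))
saturated c w = trans (cong s₂ (regroup c w)) (s₂-step {1} (c + suc c * w) (s≤s (s≤s z≤n)))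
  where
  open +-*-Solver
  regroup : ∀ c w → c + suc c * (1 + w * 2) ≡ 1 + (c + suc c * w) * 2
  regroup = solve 2 (λ c w → c :+ (con 1 :+ c) :* (con 1 :+ w :* con 2) := con 1 :+ (c :+ (con 1 :+ c) :* w) :* con 2) refl

kill-sound : ∀ k c m {Q n L} → T (kill k c m Q) → Matches Q n L → s₂ (c + k * n) + m ≤ L + slack
killOnes-sound : ∀ k fuel c m {Q n L} → T (killOnes k fuel c m Q) → MatchesOnes Q n L →
                 s₂ (c + k * n) + m ≤ L + slack
kill-sound k c m h (end {v} {ℓ} refl refl) =
  ≤-trans (+-monoˡ-≤ m (s₂≤weight 20 (c + k * v))) (≤ᵇ⇒≤ (weight 20 (c + k * v) + m) (ℓ + slack) h)
kill-sound k c m h (segment {v} {ℓ} {p} {Q} {w = w} {m′} p≡ refl refl o) = after p p≡ h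
  where
  x = c + k * v
  open +-*-Solver
  regroup₁ : ∀ c k v p w → c + k * (v + p * w) ≡ c + k * v + k * (p * w)
  regroup₁ = solve 5 (λ c k v p w → c :+ k :* (v :+ p :* w) := c :+ k :* v :+ k :* (p :* w)) refl
  regroup₂ : ∀ r q p k w → r + q * p + k * (p * w) ≡ r + p * (q + k * w)
  regroup₂ = solve 5 (λ r q p k w → r :+ q :* p :+ k :* (p :* w) := r :+ p :* (q :+ k :* w)) refl
  regroup₃ : ∀ r s m d → r + s + (m + d) ≡ (s + m) + (r + d)
  regroup₃ = solve 4 (λ r s m d → r :+ s :+ (m :+ d) := (s :+ m) :+ (r :+ d)) refl
  regroup₄ : ∀ a b c → a + b + c ≡ c + a + b
  regroup₄ = solve 3 (λ a b c → a :+ b :+ c := c :+ a :+ b) refl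
  after : ∀ p → p ≡ 2 ^ ℓ → T (killAfter k m ℓ p x Q) →
          s₂ (c + k * (v + p * w)) + m ≤ ℓ + m′ + slack
  after zero      p≡ h with () ← trans p≡ (sym (m+[n∸m]≡n (m^n>0 2 ℓ)))
  after p@(suc _) p≡ h = begin
    s₂ (c + k * (v + p * w)) + m          ≡⟨ cong (_+ m) s₂≡ ⟩
    s₂ r + s₂ (q + k * w) + m             ≤⟨ +-monoʳ-≤ (s₂ r + s₂ (q + k * w)) (m≤n+m∸n m d) ⟩
    s₂ r + s₂ (q + k * w) + (d + (m ∸ d)) ≡⟨ cong (s₂ r + s₂ (q + k * w) +_) (+-comm d (m ∸ d)) ⟩
    s₂ r + s₂ (q + k * w) + (m ∸ d + d)   ≡⟨ regroup₃ (s₂ r) (s₂ (q + k * w)) (m ∸ d) d ⟩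
    (s₂ (q + k * w) + (m ∸ d)) + (s₂ r + d)
      ≤⟨ +-mono-≤ (killOnes-sound k 20 q (m ∸ d) {Q} h o) r+d≤ℓ ⟩
    m′ + slack + ℓ                        ≡⟨ regroup₄ m′ slack ℓ ⟩
    ℓ + m′ + slack                        ∎
    where
    open ≤-Reasoning
    q = x / p
    r = x % p
    -- At most the number of zeros among the low `ℓ` digits of the product, as `weight` may
    -- overestimate; the error is on the safe side.
    d = ℓ ∸ weight 20 r
    r< : r < 2 ^ ℓ
    r< = subst (r <_) p≡ (m%n<n x p)
    r+d≤ℓ : s₂ r + d ≤ ℓ
    r+d≤ℓ = ≤-trans (+-monoʳ-≤ (s₂ r) (∸-monoʳ-≤ ℓ (s₂≤weight 20 r)))
                    (≤-reflexive (m+[n∸m]≡n (s₂-≤-length ℓ r<)))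
    s₂≡ : s₂ (c + k * (v + p * w)) ≡ s₂ r + s₂ (q + k * w)
    s₂≡ = trans (cong s₂ (trans (regroup₁ c k v p w)
                   (trans (cong (_+ k * (p * w)) (m≡m%n+[m/n]*n x p)) (regroup₂ r q p k w))))
                (trans (cong (λ p → s₂ (r + p * (q + k * w))) p≡) (s₂-shift ℓ (q + k * w) r<))
killOnes-sound k (suc fuel) c m {Q} h (stop q) =
  kill-sound k c m (proj₁ (∧-split (kill k c m Q) h)) q
killOnes-sound k (suc fuel) c m {Q} h (more {w} {L} o) with suc c ≟ k
... | yes refl =
  subst (λ s → s + m ≤ suc L + slack) (sym (saturated c w)) (s≤s (killOnes-sound k (suc fuel) c m h o))
... | no  c≢ =
  subst (λ x → s₂ x + m ≤ suc L + slack) (sym (read-one c k w))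
        (spend-sound k (c + k) m w (killOnes-sound k fuel ((c + k) / 2) (spend ((c + k) % 2) m) h₂ o))
  where
  else : ∀ b {y} → ¬ T b → T (if b then true else y) → T y
  else true  ¬b _ = contradiction tt ¬b
  else false _  h = h
  h₂ : T (killOnes k fuel ((c + k) / 2) (spend ((c + k) % 2) m) Q)
  h₂ = else (suc c ≡ᵇ k) (λ eq → c≢ (≡ᵇ⇒≡ (suc c) k eq)) (proj₂ (∧-split (kill k c m Q) h))

∨-split : ∀ x {y} → T (x ∨ y) → T x ⊎ T y
∨-split x = Equivalence.to (T-∨ {x})

-- The product may be longer than n, and ones left in the final carry have to be offset by zeros in
-- excess of `suc j`. The slack on both sides lets up to 24 such zeros be registered.
beats : (j k : ℕ) → Pattern → Bool
beats j k Q = (0 <ᵇ k) ∧ kill k 0 (suc (j + slack)) Q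

beats-sound : ∀ j k {Q n L} → T (beats j k Q) → Matches Q n L → s₂ n + j ≡ L → Flimsy n
beats-sound j k {Q} {n} h q refl with ∧-split (0 <ᵇ k) h
... | k>0 , h = k , <ᵇ⇒< 0 k k>0 , +-cancelʳ-≤ (j + slack) (suc (s₂ (k * n))) (s₂ n) (begin
  suc (s₂ (k * n)) + (j + slack)     ≡⟨ +-suc (s₂ (k * n)) (j + slack) ⟨
  s₂ (k * n) + suc (j + slack)       ≤⟨ kill-sound k 0 (suc (j + slack)) h q ⟩
  s₂ n + j + slack                   ≡⟨ +-assoc (s₂ n) j slack ⟩
  s₂ n + (j + slack)                 ∎)
  where open ≤-Reasoning

-- Some multiples with few ones are far too large to be found by trying multipliers in order.
lightMultiple : (j ℓ n N : ℕ) → Bool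
lightMultiple j ℓ n N = (rem N n ≡ᵇ 0) ∧ (0 <ᵇ N) ∧ (weight 400 N + j <ᵇ ℓ)

-- Only the multiple is tabulated, and the multiplier is recovered as the quotient. A weight fuel of
-- 400 covers 1600 binary digits, enough for the largest tabulated multiple `1 + 2 ^ 1480`; a
-- multiple `1 + 2 ^ a` with `a > 0` has two ones and so beats every divisor with at least three.
lightMultiple-sound : ∀ j ℓ n N → T (lightMultiple j ℓ n N) → s₂ n + j ≡ ℓ → Flimsy n
lightMultiple-sound j ℓ n N h eq
  with h₁ , h₂₃ ← ∧-split (rem N n ≡ᵇ 0) h
  with h₂ , h₃  ← ∧-split (0 <ᵇ N) h₂₃ = conclude n (≡ᵇ⇒≡ (rem N n) 0 h₁) (<ᵇ⇒< 0 N h₂) eq (<ᵇ⇒< (weight 400 N + j) ℓ h₃)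
  where
  conclude : ∀ n → rem N n ≡ 0 → N > 0 → s₂ n + j ≡ ℓ → weight 400 N + j < ℓ → Flimsy n
  conclude zero      refl () _ _
  conclude n@(suc _) N%n≡0 N>0 refl lt with m%n≡0⇒n∣m N n N%n≡0
  ... | divides k N≡ = k , n≢0⇒n>0 (λ {refl → n≮0 (subst (0 <_) N≡ N>0)}) ,
    ≤-<-trans (subst (λ x → s₂ x ≤ weight 400 N) N≡ (s₂≤weight 400 N)) (+-cancelʳ-< j (weight 400 N) (s₂ n) lt)

-- Recognising complementary families and resolving patterns

module _ (form : ℕ → Bool) where

  HasForm : ℕ → Set
  HasForm n = ∃[ x ] ∃[ s ] (T (form x) × x < 2 ^ s × suc (n + x) ≡ suc x * 2 ^ s)

  -- x is determined by the low j digits of a number x 1ⁱ x̄ with |x| = j; below, p is 2 ^ j.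
  hasFormEnd : (x v a : ℕ) → Bool
  hasFormEnd x v a = (v + suc x ≡ᵇ suc x * 2 ^ a) ∧ (x <ᵇ 2 ^ a) ∧ form x

  -- The run must lie in the middle block: the digits below it are ones followed by `x̄`, those
  -- above it are `x` followed by ones. Since |x| is fixed to `j`, no other block can have unbounded
  -- length, and a second run is rejected.
  hasFormSegment : (x v q j : ℕ) → Pattern → Bool
  hasFormSegment x v q j (end w ℓ)           = (v + suc x ≡ᵇ q) ∧ (suc w ≡ᵇ suc x * 2 ^ (ℓ ∸ j)) ∧ form x
  hasFormSegment x v q j (segment _ _ _ _)   = false

  hasForm : (j p : ℕ) → Pattern → Bool
  hasForm j p (end v ℓ)         = hasFormEnd (p ∸ suc (rem v p)) v (ℓ ∸ j)
  hasForm j p (segment v ℓ q Q) = hasFormSegment (p ∸ suc (rem v p)) v q j Q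

  ones-end : ∀ {v ℓ w L} → MatchesOnes (end v ℓ) w L → ∃[ i ] suc w ≡ suc v * 2 ^ i
  ones-end {v} (stop (end refl refl)) = 0 , sym (*-identityʳ (suc v))
  ones-end {v} (more {w} o) with ones-end o
  ... | i , eq = suc i , (begin
    suc w * 2              ≡⟨ cong (_* 2) eq ⟩
    suc v * 2 ^ i * 2      ≡⟨ *-assoc (suc v) (2 ^ i) 2 ⟩
    suc v * (2 ^ i * 2)    ≡⟨ cong (suc v *_) (*-comm (2 ^ i) 2) ⟩
    suc v * 2 ^ suc i      ∎)
    where open ≡-Reasoning

  hasFormEnd-sound : ∀ x v a → T (hasFormEnd x v a) → HasForm v
  hasFormEnd-sound x v a h
    with h₁ , h₂₃ ← ∧-split (v + suc x ≡ᵇ suc x * 2 ^ a) h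
    with h₂ , h₃  ← ∧-split (x <ᵇ 2 ^ a) h₂₃ =
    x , a , h₃ , <ᵇ⇒< x (2 ^ a) h₂ , trans (sym (+-suc v x)) (≡ᵇ⇒≡ (v + suc x) (suc x * 2 ^ a) h₁)

  hasFormSegment-sound : ∀ x v ℓ q j Q {w L} → T (hasFormSegment x v q j Q) → q ≡ 2 ^ ℓ →
                         MatchesOnes Q w L → HasForm (v + q * w)
  hasFormSegment-sound x v ℓ q j (end u m) {w} h q≡ o
    with h₁ , h₂₃ ← ∧-split (v + suc x ≡ᵇ q) h
    with h₂ , h₃  ← ∧-split (suc u ≡ᵇ suc x * 2 ^ (m ∸ j)) h₂₃
    with i , w≡ ← ones-end o =
    x , ℓ + (m ∸ j + i) , h₃ , x< , (begin
      suc (v + q * w + x)                      ≡⟨ regroup v (q * w) x ⟩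
      v + suc x + q * w                        ≡⟨ cong (_+ q * w) v+x≡q ⟩
      q + q * w                                ≡⟨ *-suc q w ⟨
      q * suc w                                ≡⟨ cong₂ _*_ q≡ w≡ ⟩
      2 ^ ℓ * (suc u * 2 ^ i)                  ≡⟨ cong (λ u → 2 ^ ℓ * (u * 2 ^ i)) (≡ᵇ⇒≡ (suc u) (suc x * 2 ^ (m ∸ j)) h₂) ⟩
      2 ^ ℓ * (suc x * 2 ^ (m ∸ j) * 2 ^ i)    ≡⟨ regroup′ (2 ^ ℓ) (suc x) (2 ^ (m ∸ j)) (2 ^ i) ⟩
      suc x * (2 ^ ℓ * (2 ^ (m ∸ j) * 2 ^ i))  ≡⟨ cong (λ p → suc x * (2 ^ ℓ * p)) (^-distribˡ-+-* 2 (m ∸ j) i) ⟨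
      suc x * (2 ^ ℓ * 2 ^ (m ∸ j + i))        ≡⟨ cong (suc x *_) (^-distribˡ-+-* 2 ℓ (m ∸ j + i)) ⟨
      suc x * 2 ^ (ℓ + (m ∸ j + i))            ∎)
    where
    open ≡-Reasoning
    open +-*-Solver
    v+x≡q : v + suc x ≡ q
    v+x≡q = ≡ᵇ⇒≡ (v + suc x) q h₁
    x< : x < 2 ^ (ℓ + (m ∸ j + i))
    x< = ≤-trans (subst (suc x ≤_) (trans v+x≡q q≡) (m≤n+m (suc x) v)) (^-monoʳ-≤ 2 (m≤m+n ℓ (m ∸ j + i)))
    regroup : ∀ v y x → suc (v + y + x) ≡ v + suc x + y
    regroup = solve 3 (λ v y x → con 1 :+ (v :+ y :+ x) := v :+ (con 1 :+ x) :+ y) refl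
    regroup′ : ∀ p x a b → p * (x * a * b) ≡ x * (p * (a * b))
    regroup′ = solve 4 (λ p x a b → p :* (x :* a :* b) := x :* (p :* (a :* b))) refl

  hasForm-sound : ∀ j p {Q n L} → T (hasForm j p Q) → Matches Q n L → HasForm n
  hasForm-sound j p {end v ℓ}         h (end refl _)          = hasFormEnd-sound (p ∸ suc (rem v p)) v (ℓ ∸ j) h
  hasForm-sound j p {segment v ℓ q Q} h (segment q≡ refl _ o) =
    hasFormSegment-sound (p ∸ suc (rem v p)) v ℓ q j Q h q≡ o

  module Resolve (j p : ℕ) (starMultipliers multipliers lights sporadic : List ℕ) where

    Outcome : ℕ → Set
    Outcome n = Flimsy n ⊎ (n ∈ sporadic ⊎ HasForm n)

    -- The form is tested on patterns with a run as well, because all members of a complementary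
    -- family are sturdy and splitting alone would never dispose of them. Exhausted fuel counts as
    -- failure.
    resolve : ℕ → List Token → Bool
    decide  : ℕ → List Token → Pattern → Bool
    resolve zero       P = false
    resolve (suc fuel) P = decide fuel P (compile P (end 0 0))
    decide fuel P Q@(end v ℓ) =
      hasForm j p Q ∨ any (λ k → beats j k Q) multipliers ∨ any (lightMultiple j ℓ v) lights ∨ any (v ≡ᵇ_) sporadic
    decide fuel P Q@(segment _ _ _ _) =
      hasForm j p Q ∨ any (λ k → beats j k Q) starMultipliers ∨ all (resolve fuel) (expand P)

    beaten : ∀ ks {Q n L} → T (any (λ k → beats j k Q) ks) → Matches Q n L → s₂ n + j ≡ L → Flimsy n
    beaten ks {Q} h q eq with k , h ← satisfied (any⁻ (λ k → beats j k Q) ks h) = beats-sound j k h q eq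

    resolve-sound : ∀ fuel P {n L} → T (resolve fuel P) → Denotes P n L → s₂ n + j ≡ L → Outcome n
    decide-sound : ∀ fuel P Q {n L} → T (decide fuel P Q) → Denotes P n L → Matches Q n L → s₂ n + j ≡ L → Outcome n
    resolve-sound (suc fuel) P {n} {L} h d eq =
      decide-sound fuel P (compile P (end 0 0)) h d
        (subst₂ (Matches (compile P (end 0 0))) (trans (cong (n +_) (*-zeroʳ (2 ^ L))) (+-identityʳ n)) (+-identityʳ L)
          (compile-sound d (end refl refl))) eq
    decide-sound fuel P Q@(end v ℓ) h d q@(end refl refl) eq with ∨-split (hasForm j p Q) h
    ... | inj₁ h = inj₂ (inj₂ (hasForm-sound j p h q))
    ... | inj₂ h with ∨-split (any (λ k → beats j k Q) multipliers) h
    ... | inj₁ h = inj₁ (beaten multipliers h q eq)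
    ... | inj₂ h with ∨-split (any (lightMultiple j ℓ v) lights) h
    ... | inj₁ h with N , h ← satisfied (any⁻ (lightMultiple j ℓ v) lights h) = inj₁ (lightMultiple-sound j ℓ v N h eq)
    ... | inj₂ h = inj₂ (inj₁ (Any.map (≡ᵇ⇒≡ v _) (any⁻ (v ≡ᵇ_) sporadic h)))
    decide-sound fuel P Q@(segment _ _ _ _) h d q eq with ∨-split (hasForm j p Q) h
    ... | inj₁ h = inj₂ (inj₂ (hasForm-sound j p h q))
    ... | inj₂ h with ∨-split (any (λ k → beats j k Q) starMultipliers) h
    ... | inj₁ h = inj₁ (beaten starMultipliers h q eq)
    ... | inj₂ h = go (expand P) (All.all⁺ (resolve fuel) (expand P) h) (expand-sound d)
      where
      go : ∀ Ps → All (T ∘ resolve fuel) Ps → Any (λ P → Denotes P _ _) Ps → Outcome _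
      go (P ∷ _) (h All.∷ _) (here d)  = resolve-sound fuel P h d eq
      go (_ ∷ _) (_ All.∷ hs) (there d) = go _ hs d

-- Searching the tree of digit patterns

-- Rest e z w L: w has L digits, z of them 0, and its leading digit is 1; e tells whether w may be
-- empty, that is, whether the digit below w is a 1.
data Rest : Bool → (z w L : ℕ) → Set where
  end : Rest true 0 0 0
  one : ∀ {e z w L} → Rest true z w L → Rest e z (1 + w * 2) (suc L)
  nil : ∀ {e z w L} → Rest false z w L → Rest e (suc z) (0 + w * 2) (suc L)

Rest-weaken : ∀ {e z w L} → Rest e z w L → Rest true z w L
Rest-weaken end     = end
Rest-weaken (one r) = one r
Rest-weaken (nil r) = nil r

Rest-< : ∀ {e z w L} → Rest e z w L → w < 2 ^ L
Rest-< end = s≤s z≤n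
Rest-< (one {w = w} {L} r) = subst₂ _≤_ refl (*-comm (2 ^ L) 2) (*-monoˡ-≤ 2 (Rest-< r))
Rest-< (nil {w = w} {L} r) = ≤-trans (n≤1+n _) (subst₂ _≤_ refl (*-comm (2 ^ L) 2) (*-monoˡ-≤ 2 (Rest-< r)))

rest : ∀ n → n > 0 → ∃[ L ] (Rest false (zeros n) n L × s₂ n + zeros n ≡ L)
rest = binary-ind _ (λ ()) step
  where
  step : ∀ {d} n → d < 2 → (n > 0 → ∃[ L ] (Rest false (zeros n) n L × s₂ n + zeros n ≡ L)) →
         d + n * 2 > 0 → ∃[ L ] (Rest false (zeros (d + n * 2)) (d + n * 2) L × s₂ (d + n * 2) + zeros (d + n * 2) ≡ L)
  step {0} zero      d<2 ih ()
  step {1} zero      d<2 ih _ = 1 , one end , refl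
  step {0} n@(suc _) d<2 ih _ with L , r , eq ← ih z<s
    rewrite zeros-step 0 n z<s d<2 | s₂-step {0} n d<2 | +-comm (zeros n) 1 =
    suc L , nil r , trans (+-suc (s₂ n) (zeros n)) (cong suc eq)
  step {1} n@(suc _) d<2 ih _ with L , r , eq ← ih z<s
    rewrite zeros-step 1 n z<s d<2 | s₂-step {1} n d<2 | +-identityʳ (zeros n) =
    suc L , one (Rest-weaken r) , cong suc eq
  step {suc (suc _)} n (s≤s (s≤s ())) ih _

-- Padded to b digits more than n, where k ≤ 2 ^ b, the product k * n must have at least j + b + 1 zeros
-- for k to beat n.  In state k b c m the carry is c and m of these zeros are still missing.
data State : Set where
  state : (k b c m : ℕ) → State

-- The padding has room for the final carry, so its ones are already accounted for. Hence `m ≡ 0`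
-- settles every continuation of the digits read so far, and no slack as in `kill` is called for.
finished saturatedᵇ ended : State → Bool
finished   (state k b c m) = m ≡ᵇ 0
saturatedᵇ (state k b c m) = suc c ≡ᵇ k
ended      (state k b c m) = weight 2 c + m ≤ᵇ b

readOne readZero : State → State
readOne  (state k b c m) = state k b ((c + k) / 2) (spend ((c + k) % 2) m)
readZero (state k b c m) = state k b (c / 2) (spend (c % 2) m)

-- z zeros are still to be read.  After r further ones the current run is taken to have arbitrary
-- length, and only the multipliers whose carry is saturated are kept.
module Tree (cap : ℕ) (leaf : List Token → Bool) where

  node : (z r : ℕ) → Bool → List State → List Token → Bool
  ones : (z r : ℕ) → List State → List Token → Bool
  next : (z : ℕ) → Bool → List State → List Token → Bool
  node z r e S P = any finished S ∨ (ones z r S P ∧ next z e S P)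
  -- The current run is arbitrary already: another one leaves saturated states and the pattern as
  -- they are.
  ones z zero          S P = true
  ones z (suc zero)    S P = node z zero true (filterᵇ saturatedᵇ (map readOne S)) (⋆ ∷ 𝟙 ∷ P)
  ones z (suc (suc r)) S P = node z (suc r) true (map readOne S) (𝟙 ∷ P)
  next zero    true  S P = any ended S ∨ leaf P
  -- The last digit read is 0 and no zeros remain, so a number can neither stop here nor continue
  -- with a zero.
  next zero    false S P = true
  next (suc z) e     S P = node z (suc cap) false (map readZero S) (𝟘 ∷ P)

  module Sound (n total : ℕ) (Success : Set)
               (leaf-sound : ∀ P → T (leaf P) → Denotes P n total → Success) where

    -- An invariant in continuation form: what is still to be shown about the unread part `w`
    -- implies the final goal, so the digits already produced need not be remembered. The two bounds
    -- keep the product within `L + b` digits.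
    Good : (w L : ℕ) → State → Set
    Good w L (state k b c m) = c < 2 ^ b × k ≤ 2 ^ b × (s₂ (c + k * w) + m ≤ L + b → Success)

    good-finished : ∀ {w L} s → w < 2 ^ L → T (finished s) → Good w L s → Success
    good-finished {w} {L} (state k b c m) w< h (c< , k≤ , continue) with refl ← ≡ᵇ⇒≡ m 0 h =
      continue (subst (_≤ L + b) (sym (+-identityʳ _)) (s₂-≤-length (L + b) (begin-strict
        c + k * w              <⟨ +-mono-<-≤ c< (*-monoˡ-≤ w k≤) ⟩
        2 ^ b + 2 ^ b * w      ≡⟨ *-suc (2 ^ b) w ⟨
        2 ^ b * suc w          ≤⟨ *-monoʳ-≤ (2 ^ b) w< ⟩
        2 ^ b * 2 ^ L          ≡⟨ ^-distribˡ-+-* 2 b L ⟨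
        2 ^ (b + L)            ≡⟨ cong (2 ^_) (+-comm b L) ⟩
        2 ^ (L + b)            ∎)))
      where open ≤-Reasoning

    good-ended : ∀ s → T (ended s) → Good 0 0 s → Success
    good-ended (state k b c m) h (_ , _ , continue) =
      continue (subst (λ x → s₂ x + m ≤ b) (sym (trans (cong (c +_) (*-zeroʳ k)) (+-identityʳ c)))
        (≤-trans (+-monoˡ-≤ m (s₂≤weight 2 c)) (≤ᵇ⇒≤ (weight 2 c + m) b h)))

    good-one : ∀ {w L} s → Good (1 + w * 2) (suc L) s → Good w L (readOne s)
    good-one {w} {L} (state k b c m) (c< , k≤ , continue) =
      m<n*o⇒m/o<n (subst (c + k <_) (trans (cong (2 ^ b +_) (sym (+-identityʳ (2 ^ b)))) (*-comm 2 (2 ^ b))) (+-mono-<-≤ c< k≤)) , k≤ ,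
      λ h → continue (subst (λ x → s₂ x + m ≤ suc L + b) (sym (read-one c k w)) (spend-sound k (c + k) m w h))

    good-zero : ∀ {w L} s → Good (0 + w * 2) (suc L) s → Good w L (readZero s)
    good-zero {w} {L} (state k b c m) (c< , k≤ , continue) =
      ≤-<-trans (m/n≤m c 2) c< , k≤ , λ h → continue (spend-sound k c m w h)

    good-saturated : ∀ {w L} s → T (saturatedᵇ s) → Good (1 + w * 2) (suc L) s → Good w L s
    good-saturated {w} {L} (state k b c m) sat (c< , k≤ , continue) with refl ← ≡ᵇ⇒≡ (suc c) k sat =
      c< , k≤ , λ h → continue (subst (λ s → s + m ≤ suc L + b) (sym (saturated c w)) (s≤s h))

    any-good : ∀ {G : State → Set} f S → (∀ s → T (f s) → G s → Success) → T (any f S) → All G S → Success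
    any-good f (s ∷ S) good h (g All.∷ gs) with ∨-split (f s) h
    ... | inj₁ h = good s h g
    ... | inj₂ h = any-good f S good h gs

    filter-saturated : ∀ {G : State → Set} S → All G S → All (λ s → T (saturatedᵇ s) × G s) (filterᵇ saturatedᵇ S)
    filter-saturated []      All.[]         = All.[]
    filter-saturated (s ∷ S) (g All.∷ gs) with saturatedᵇ s in sat
    ... | true  = (subst T (sym sat) tt , g) All.∷ filter-saturated S gs
    ... | false = filter-saturated S gs

    Position : List Token → (w L : ℕ) → Set
    Position P w L = ∃[ v ] ∃[ ℓ ] (Denotes P v ℓ × n ≡ v + 2 ^ ℓ * w × total ≡ ℓ + L)

    position-one : ∀ {P Q w L} → (∀ {v ℓ} → Denotes P v ℓ → Denotes Q (v + 2 ^ ℓ) (suc ℓ)) →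
                   Position P (1 + w * 2) (suc L) → Position Q w L
    position-one {w = w} {L} extend (v , ℓ , d , n≡ , t≡) =
      v + 2 ^ ℓ , suc ℓ , extend d ,
      trans n≡ (trans (shift-low v ℓ 1 w) (cong (λ p → v + p + 2 ^ suc ℓ * w) (+-identityʳ (2 ^ ℓ)))) ,
      trans t≡ (+-suc ℓ L)

    position-zero : ∀ {P w L} → Position P (0 + w * 2) (suc L) → Position (𝟘 ∷ P) w L
    position-zero {w = w} {L} (v , ℓ , d , n≡ , t≡) =
      v , suc ℓ , 𝟘 d , trans n≡ (trans (shift-low v ℓ 0 w) (cong (_+ 2 ^ suc ℓ * w) (+-identityʳ v))) , trans t≡ (+-suc ℓ L)

    position-end : ∀ {P} → Position P 0 0 → Denotes P n total
    position-end (v , ℓ , d , refl , refl) =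
      subst₂ (Denotes _) (sym (trans (cong (v +_) (*-zeroʳ (2 ^ ℓ))) (+-identityʳ v))) (sym (+-identityʳ ℓ)) d

    node-sound : ∀ z r e S P {w L} → T (node z (suc r) e S P) → Rest e z w L →
                 All (Good w L) S → Position P w L → Success
    -- Inside an arbitrary run the recursion consumes the ones of `n` while the tree stays at the
    -- same node; saturation makes the states invariant.
    star-sound : ∀ z e S P {w L} → T (node z zero true S (⋆ ∷ P)) → Rest e z w L →
                 All (λ s → T (saturatedᵇ s) × Good w L s) S → Position (⋆ ∷ P) w L → Success
    ones-sound : ∀ z r S P {w L} → T (ones z (suc r) S P) → Rest true z w L →
                 All (Good (1 + w * 2) (suc L)) S → Position P (1 + w * 2) (suc L) → Success
    next-sound : ∀ z S P e {w L} → T (next (suc z) e S P) → Rest false z w L →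
                 All (Good (0 + w * 2) (suc L)) S → Position P (0 + w * 2) (suc L) → Success
    end-sound : ∀ S P → T (next 0 true S P) → All (Good 0 0) S → Position P 0 0 → Success
    end-sound S P h gs pos with ∨-split (any ended S) h
    ... | inj₁ h = any-good ended S good-ended h gs
    ... | inj₂ h = leaf-sound P h (position-end pos)
    next-sound z S P e h r gs pos =
      node-sound z cap false (map readZero S) (𝟘 ∷ P) h r (All.map⁺ (All.map (λ {s} → good-zero s) gs)) (position-zero pos)
    ones-sound z zero    S P h r gs pos =
      star-sound z true (filterᵇ saturatedᵇ (map readOne S)) (𝟙 ∷ P) h r
        (filter-saturated (map readOne S) (All.map⁺ (All.map (λ {s} → good-one s) gs)))
        (position-one (λ d → ⋆-stop (𝟙 d)) pos)
    ones-sound z (suc r) S P h rest gs pos =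
      node-sound z r true (map readOne S) (𝟙 ∷ P) h rest (All.map⁺ (All.map (λ {s} → good-one s) gs)) (position-one 𝟙 pos)
    node-sound z r e S P h rest gs pos with ∨-split (any finished S) h
    ... | inj₁ h = any-good finished S (λ s → good-finished s (Rest-< rest)) h gs
    ... | inj₂ h with h₁ , h₂ ← ∧-split (ones z (suc r) S P) h with rest
    ... | end       = end-sound S P h₂ gs pos
    ... | one rest′ = ones-sound z r S P h₁ rest′ gs pos
    ... | nil rest′ = next-sound _ S P e h₂ rest′ gs pos
    star-sound z e S P h rest gs pos with ∨-split (any finished S) h
    ... | inj₁ h′ = any-good finished S (λ s → good-finished s (Rest-< rest)) h′ (All.map proj₂ gs)
    ... | inj₂ h₂ with rest
    ... | end       = end-sound S (⋆ ∷ P) h₂ (All.map proj₂ gs) pos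
    ... | one rest′ = star-sound z true S P h rest′
          (All.map (λ {s} (sat , g) → sat , good-saturated s sat g) gs) (position-one ⋆-more pos)
    ... | nil rest′ = next-sound _ S (⋆ ∷ P) true h₂ rest′ (All.map proj₂ gs) pos

bitLength : ℕ → ℕ
bitLength k = least (λ b → k ≤ᵇ 2 ^ b) 10 0

initial : ℕ → ℕ → State
initial j k = state k (bitLength k) 0 (suc (j + bitLength k))

-- An odd number begins with a one, so the tree is entered at `ones`. Runs become arbitrary at their
-- third one: for 3, 5 and 7 three ones saturate any carry below k, since `k ∸ c` goes at worst
-- through 7, 4, 2, 1, and thus no multiplier is lost there.
search : (j : ℕ) → List ℕ → (List Token → Bool) → Bool
search j ks leaf = all (λ k → k ≤ᵇ 2 ^ bitLength k) ks ∧ Tree.ones 2 leaf j 3 (map (initial j) ks) []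

odd⇒positive : ∀ n → Odd n → n > 0
odd⇒positive (suc n) _ = z<s

odd-rest : ∀ {z n L} → Odd n → Rest false z n L →
           ∃[ w ] ∃[ L′ ] (n ≡ 1 + w * 2 × L ≡ suc L′ × Rest true z w L′)
odd-rest odd (one {w = w} {L} r) = w , L , refl , refl , r
odd-rest odd (nil {w = w} r) with () ← trans (sym odd) (m*n%n≡0 w 2)

search-sound : ∀ j ks leaf {Outcome : Set} n → T (search j ks leaf) → Odd n → zeros n ≡ j →
               (∀ P → T (leaf P) → Denotes P n (s₂ n + j) → Outcome) →
               Any (λ k → s₂ (k * n) < s₂ n) ks ⊎ Outcome
search-sound .(zeros n) ks leaf {Outcome} n h odd refl leaf-sound
  with h₁ , h₂ ← ∧-split (all (λ k → k ≤ᵇ 2 ^ bitLength k) ks) h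
  with L , r , eq ← rest n (odd⇒positive n odd) 
  with w , L′ , n≡ , L≡ , r′ ← odd-rest odd r =
  S.ones-sound j 2 (map (initial j) ks) [] h₂ r′
    (subst₂ (λ x L → All (S.Good x L) (map (initial j) ks)) n≡ L≡ goods)
    (0 , 0 , [] , trans n≡ (sym (+-identityʳ (1 + w * 2))) , trans eq L≡)
  where
  j = zeros n
  Success = Any (λ k → s₂ (k * n) < s₂ n) ks ⊎ Outcome
  module S = Tree.Sound 2 leaf n (s₂ n + j) Success (λ P l d → inj₂ (leaf-sound P l d))
  good : ∀ k → k ∈ ks → T (k ≤ᵇ 2 ^ bitLength k) → S.Good n L (initial j k)
  good k k∈ks k≤ = m^n>0 2 b , ≤ᵇ⇒≤ k (2 ^ b) k≤ , λ le → inj₁ (lose k∈ks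
    (+-cancelʳ-≤ (j + b) (suc (s₂ (k * n))) (s₂ n) (begin
      suc (s₂ (k * n)) + (j + b)   ≡⟨ +-suc (s₂ (k * n)) (j + b) ⟨
      s₂ (k * n) + suc (j + b)     ≤⟨ le ⟩
      L + b                        ≡⟨ cong (_+ b) eq ⟨
      s₂ n + j + b                 ≡⟨ +-assoc (s₂ n) j b ⟩
      s₂ n + (j + b)               ∎)))
    where
    open ≤-Reasoning
    b = bitLength k
  goods : All (S.Good n L) (map (initial j) ks)
  goods = All.map⁺ (All.tabulate (λ {k} k∈ks → good k k∈ks (All.lookup (All.all⁺ _ ks h₁) k∈ks)))

-- The search data and the exceptions for each number of zeros

-- The first argument decides between the two alternatives, so a multiplier is obtained from `¬ E n`
-- constructively.
flimsyExcept : ∀ {j} {E : ℕ → Set} → (∀ n → Odd n → zeros n ≡ j → Flimsy n ⊎ E n) →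
               (∀ n → E n → Sturdy n) → OddFlimsyExcept j E
flimsyExcept complete sturdy =
  (λ n odd z → mk⇔ (λ flimsy e → sturdy n e flimsy)
                   (λ ¬e → either (λ flimsy → flimsy) (λ e → contradiction e ¬e) (complete n odd z))) ,
  sturdy

-- The next three lists were found by greedy covering of the patterns that remain to be beaten.
-- runMultipliers is for patterns with a run of unbounded length.
runMultipliers : List ℕ
runMultipliers =
  11 ∷ 9 ∷ 17 ∷ 13 ∷ 19 ∷ 23 ∷ 37 ∷ 21 ∷ 15 ∷ 29 ∷ 25 ∷ 31 ∷ 33 ∷ 43 ∷ 47 ∷ 27 ∷ 49 ∷ 35 ∷ 73 ∷
  41 ∷ 59 ∷ 89 ∷ 45 ∷ 61 ∷ 39 ∷ 65 ∷ 141 ∷ 83 ∷ 53 ∷ 51 ∷ 57 ∷ 109 ∷ 81 ∷ 71 ∷ 79 ∷ 155 ∷ 63 ∷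
  177 ∷ 293 ∷ 55 ∷ 93 ∷ 129 ∷ 95 ∷ 85 ∷ 175 ∷ 77 ∷ 75 ∷ 97 ∷ 67 ∷ 101 ∷ 69 ∷ 107 ∷ 149 ∷ 91 ∷
  105 ∷ 103 ∷ 139 ∷ 161 ∷ 151 ∷ 111 ∷ 145 ∷ 185 ∷ 203 ∷ 341 ∷ 299 ∷ 173 ∷ 555 ∷ 121 ∷ 127 ∷
  163 ∷ 4033 ∷ 16257 ∷ 65281 ∷ 261633 ∷ 257 ∷ 961 ∷ 513 ∷ 1025 ∷ 511 ∷ []

multipliers : List ℕ
multipliers =
  13 ∷ 41 ∷ 19 ∷ 11 ∷ 29 ∷ 23 ∷ 17 ∷ 25 ∷ 21 ∷ 43 ∷ 27 ∷ 37 ∷ 53 ∷ 61 ∷ 81 ∷ 113 ∷ 91 ∷ 57 ∷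
  49 ∷ 39 ∷ 73 ∷ 269 ∷ 59 ∷ 137 ∷ 55 ∷ 183 ∷ 75 ∷ 97 ∷ 107 ∷ 45 ∷ 545 ∷ 87 ∷ 145 ∷ 99 ∷ 205 ∷
  313 ∷ 69 ∷ 83 ∷ 51 ∷ 157 ∷ 101 ∷ 77 ∷ 67 ∷ 133 ∷ 289 ∷ 167 ∷ 291 ∷ 683 ∷ 123 ∷ 217 ∷ 15 ∷
  141 ∷ 121 ∷ 331 ∷ 235 ∷ 103 ∷ 161 ∷ 537 ∷ 337 ∷ 449 ∷ 31 ∷ 185 ∷ 279 ∷ 125 ∷ 209 ∷ 93 ∷ 35 ∷
  111 ∷ 193 ∷ 109 ∷ 153 ∷ 221 ∷ 119 ∷ 117 ∷ 213 ∷ 355 ∷ 195 ∷ 281 ∷ 177 ∷ 267 ∷ 343 ∷ 47 ∷ 85 ∷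
  251 ∷ 363 ∷ 247 ∷ 273 ∷ 385 ∷ 1057 ∷ 201 ∷ 353 ∷ 551 ∷ 105 ∷ 365 ∷ 233 ∷ 453 ∷ 165 ∷ 207 ∷
  163 ∷ 169 ∷ 411 ∷ 1227 ∷ 227 ∷ 293 ∷ 801 ∷ 89 ∷ 641 ∷ 673 ∷ 211 ∷ 629 ∷ 1755 ∷ 115 ∷ 225 ∷
  333 ∷ 321 ∷ 1153 ∷ 203 ∷ 245 ∷ 253 ∷ 339 ∷ 187 ∷ 305 ∷ 347 ∷ 583 ∷ 679 ∷ 1127 ∷ 71 ∷ 223 ∷
  439 ∷ 495 ∷ 389 ∷ 397 ∷ 171 ∷ 275 ∷ 317 ∷ 417 ∷ 501 ∷ 795 ∷ 189 ∷ 249 ∷ 283 ∷ 403 ∷ 197 ∷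
  277 ∷ 483 ∷ 231 ∷ 361 ∷ 407 ∷ 441 ∷ 609 ∷ 717 ∷ 1323 ∷ 139 ∷ 179 ∷ 369 ∷ 481 ∷ 553 ∷ 823 ∷
  929 ∷ 1005 ∷ 1409 ∷ 2045 ∷ 239 ∷ 473 ∷ 925 ∷ 961 ∷ 1141 ∷ 2039 ∷ 63 ∷ 241 ∷ 401 ∷ 701 ∷ 817 ∷
  873 ∷ 1963 ∷ 215 ∷ 237 ∷ 315 ∷ 503 ∷ 505 ∷ 587 ∷ 681 ∷ 813 ∷ 1013 ∷ 147 ∷ 425 ∷ 427 ∷ 565 ∷
  657 ∷ 811 ∷ 953 ∷ 1265 ∷ 1545 ∷ 1561 ∷ 151 ∷ 229 ∷ 285 ∷ 465 ∷ 507 ∷ 555 ∷ 619 ∷ 705 ∷ 729 ∷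
  875 ∷ 893 ∷ 1001 ∷ 1089 ∷ 1257 ∷ 1285 ∷ 155 ∷ 311 ∷ 335 ∷ 375 ∷ 457 ∷ 461 ∷ 489 ∷ 569 ∷ 589 ∷
  665 ∷ 667 ∷ 741 ∷ 881 ∷ 897 ∷ 987 ∷ 997 ∷ []

-- Multiples of the numbers that none of the multipliers beats.
sparseMultiples : List ℕ
sparseMultiples = map (λ a → 1 + 2 ^ a) (
  261 ∷ 150 ∷ 182 ∷ 834 ∷ 42 ∷ 65 ∷ 76 ∷ 90 ∷ 129 ∷ 138 ∷ 144 ∷ 170 ∷ 194 ∷ 234 ∷ 294 ∷ 330 ∷
  363 ∷ 405 ∷ 950 ∷ 1026 ∷ 1110 ∷ 48 ∷ 51 ∷ 53 ∷ 54 ∷ 56 ∷ 68 ∷ 72 ∷ 105 ∷ 112 ∷ 115 ∷ 126 ∷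
  130 ∷ 131 ∷ 133 ∷ 135 ∷ 137 ∷ 165 ∷ 173 ∷ 192 ∷ 200 ∷ 230 ∷ 263 ∷ 266 ∷ 280 ∷ 324 ∷ 352 ∷
  372 ∷ 386 ∷ 392 ∷ 403 ∷ 414 ∷ 423 ∷ 429 ∷ 438 ∷ 450 ∷ 455 ∷ 474 ∷ 520 ∷ 536 ∷ 550 ∷ 556 ∷
  630 ∷ 646 ∷ 715 ∷ 774 ∷ 786 ∷ 794 ∷ 832 ∷ 966 ∷ 1060 ∷ 1154 ∷ 1165 ∷ 1302 ∷ 1346 ∷ 1472 ∷
  1480 ∷ []) ++
  558346010625 ∷ 4947835879425 ∷ 69258444801 ∷ 2183266305 ∷ 35467034625 ∷ 2199090397185 ∷
  1210056705 ∷ 9672065025 ∷ 68719511553 ∷ 8813272891905 ∷ 67109889 ∷ 134480385 ∷ 268468233 ∷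
  545267745 ∷ 2164260897 ∷ 4430233665 ∷ 68736385025 ∷ 2199023288385 ∷ 2199090364545 ∷
  4398054900225 ∷ 4432408346625 ∷ 8796126576645 ∷ 18446761665895596033 ∷ 16777761 ∷ 37748865 ∷
  67109185 ∷ 84936705 ∷ 135282693 ∷ 268763265 ∷ 269484033 ∷ 339738625 ∷ 536871237 ∷ 537657345 ∷
  537935937 ∷ 1073741825 ∷ 1073742105 ∷ 1074004225 ∷ 1075855365 ∷ 4294983825 ∷ 4303486985 ∷
  8589934661 ∷ 8590196745 ∷ 34360001025 ∷ 154753040385 ∷ 4398063550465 ∷ 70918499991553 ∷
  8391681 ∷ 8421381 ∷ 16781825 ∷ 33555015 ∷ 33556545 ∷ 33564705 ∷ 33800193 ∷ 33821697 ∷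
  42205185 ∷ 71303425 ∷ 100663569 ∷ 134287363 ∷ 134349057 ∷ 134750337 ∷ 136323081 ∷ 138420225 ∷
  138428433 ∷ 155189253 ∷ 167772227 ∷ 180355329 ∷ 268583425 ∷ 269500419 ∷ 272629765 ∷
  276825345 ∷ 285278721 ∷ 285282305 ∷ 285605889 ∷ 335765505 ∷ 537919525 ∷ 553650177 ∷
  570483207 ∷ 590426625 ∷ 607322625 ∷ 809639985 ∷ 1075841025 ∷ 1080049665 ∷ 1086341121 ∷
  1091108865 ∷ 1212157953 ∷ 2148532485 ∷ 3221291025 ∷ 4294967841 ∷ 4294975625 ∷ 4295360515 ∷
  4297068545 ∷ 4299186177 ∷ 4836032513 ∷ 6446645505 ∷ 6509563905 ∷ 17181968385 ∷ 25769803785 ∷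
  34359739425 ∷ 34359742593 ∷ 68721573891 ∷ 68728389633 ∷ 68786586625 ∷ 146029936641 ∷
  274877909505 ∷ 275146342401 ∷ 1099511627841 ∷ 2336463257601 ∷ 4398046511745 ∷ 4398583414785 ∷
  4432540467201 ∷ 6597203984385 ∷ 8796093292545 ∷ 8796126576705 ∷ 8933531979777 ∷
  17592188141577 ∷ 17593259787265 ∷ 17660905521281 ∷ 4869940435459321626625 ∷ 1114113 ∷
  4194369 ∷ 8389185 ∷ 8396801 ∷ 8405001 ∷ 8454147 ∷ 9437737 ∷ 9699345 ∷ 10485763 ∷ 12713985 ∷
  16777217 ∷ 16778241 ∷ 16793601 ∷ 16795649 ∷ 16797825 ∷ 16810625 ∷ 17040387 ∷ 17055765 ∷
  17829889 ∷ 17891361 ∷ 19136517 ∷ 20971557 ∷ 20972065 ∷ 20972097 ∷ 20980225 ∷ 33573393 ∷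
  33587289 ∷ 33621005 ∷ 34079745 ∷ 34607625 ∷ 36765729 ∷ 42043521 ∷ 58721025 ∷ 67108865 ∷
  67110913 ∷ 67112225 ∷ 67113025 ∷ 67116033 ∷ 67119105 ∷ 67174411 ∷ 67177089 ∷ 67256385 ∷
  67308033 ∷ 67634177 ∷ 67665921 ∷ 68173893 ∷ 68558913 ∷ 68681763 ∷ 68943875 ∷ 69208065 ∷
  69238785 ∷ 69240843 ∷ 76285953 ∷ 83951625 ∷ 84017153 ∷ 85067777 ∷ 100665345 ∷ 100733985 ∷
  101057025 ∷ 102760449 ∷ 102760713 ∷ 102761505 ∷ 134217729 ∷ 134217995 ∷ 134219271 ∷
  134220801 ∷ 134221185 ∷ 134221953 ∷ 134251533 ∷ 134283345 ∷ 134316105 ∷ 134349321 ∷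
  134365189 ∷ 134381569 ∷ 134746625 ∷ 134746641 ∷ 134758657 ∷ 134774793 ∷ 134807625 ∷
  134840321 ∷ 135331893 ∷ 136331273 ∷ 136347651 ∷ 137363457 ∷ 142625457 ∷ 143130625 ∷
  148373505 ∷ 151005217 ∷ 151749633 ∷ 151814145 ∷ 167772209 ∷ 167839745 ∷ 167846913 ∷
  182454273 ∷ 201326721 ∷ 201342985 ∷ 206849025 ∷ 239077377 ∷ 268469249 ∷ 268476929 ∷
  268959873 ∷ 268967937 ∷ 268992513 ∷ 269092865 ∷ 269566497 ∷ 270016513 ∷ 270630945 ∷
  271582209 ∷ 272631825 ∷ 272891905 ∷ 276832641 ∷ 276832777 ∷ 276856833 ∷ 278990881 ∷
  285212679 ∷ 285737025 ∷ 286392449 ∷ 287346761 ∷ 305135875 ∷ 318767169 ∷ 335549445 ∷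
  335806465 ∷ 339743745 ∷ 341835785 ∷ 402655365 ∷ 536871429 ∷ 536872193 ∷ 536891397 ∷
  536897801 ∷ 536940545 ∷ 537395201 ∷ 537411585 ∷ 537460749 ∷ 538443777 ∷ 545275905 ∷
  552083475 ∷ 555745345 ∷ 562561025 ∷ 570442257 ∷ 570949641 ∷ 604241925 ∷ 604897281 ∷
  610408449 ∷ 621813763 ∷ 671229513 ∷ 679485441 ∷ 708845577 ∷ 822110211 ∷ 939540481 ∷
  941621265 ∷ 1073742225 ∷ 1073743905 ∷ 1073774723 ∷ 1073782915 ∷ 1073872929 ∷ 1073938433 ∷
  1074077697 ∷ 1075052545 ∷ 1075068929 ∷ 1075839105 ∷ 1082146825 ∷ 1090912257 ∷ 1101049863 ∷
  1107298305 ∷ 1140867081 ∷ 1207961601 ∷ 1207980033 ∷ 1208397825 ∷ 1209040897 ∷ 1342717953 ∷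
  2147494401 ∷ 2147508233 ∷ 2148008961 ∷ 2148533505 ∷ 2148663297 ∷ 2151694341 ∷ 2151757137 ∷
  2155905153 ∷ 2157971979 ∷ 2164269065 ∷ 2181038145 ∷ 2181562881 ∷ 2214596865 ∷ 2215116805 ∷
  2281734147 ∷ 2282225665 ∷ 2415919121 ∷ 2415924225 ∷ 2684354569 ∷ 2684358665 ∷ 3221230593 ∷
  4294987777 ∷ 4295000129 ∷ 4296280065 ∷ 4297065537 ∷ 4299169809 ∷ 4299466353 ∷ 4300734465 ∷
  4301389825 ∷ 4304420865 ∷ 4305455105 ∷ 4311748609 ∷ 4311756801 ∷ 4330856475 ∷ 4362084369 ∷
  4564250625 ∷ 5368971267 ∷ 6442467393 ∷ 7784628225 ∷ 8589934593 ∷ 12884905985 ∷ 12886999041 ∷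
  17182982205 ∷ 17188519937 ∷ 17330864129 ∷ 19327361025 ∷ 34359738369 ∷ 34359743489 ∷
  34360000545 ∷ 34361966593 ∷ 34628175873 ∷ 36515610625 ∷ 68720001025 ∷ 68853695489 ∷
  68987912193 ∷ 69289902081 ∷ 69793218625 ∷ 137447604225 ∷ 139586438145 ∷ 154618888193 ∷
  206426865665 ∷ 274877907025 ∷ 274877907073 ∷ 274877919233 ∷ 274880006145 ∷ 549756076065 ∷
  550292946945 ∷ 550326239233 ∷ 550963773441 ∷ 584115552257 ∷ 584132329473 ∷ 618475421697 ∷
  824634245121 ∷ 826781204481 ∷ 1099511758849 ∷ 1099512152321 ∷ 1103808692225 ∷ 1717986918401 ∷
  2199023264001 ∷ 2199023272065 ∷ 2405181685761 ∷ 2473901162505 ∷ 4398050705425 ∷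
  4399120253185 ∷ 4400193994785 ∷ 4406636969985 ∷ 4432406249985 ∷ 8796095135745 ∷
  8796227241985 ∷ 13194139566081 ∷ 17592320524289 ∷ 17592454479873 ∷ 17867131060225 ∷
  71468255805441 ∷ 72057594037936129 ∷ 11805916207174113034241 ∷ 18889465931478580854801 ∷
  75557863728113346674689 ∷ 262145 ∷ 394353 ∷ 540929 ∷ 786977 ∷ 917697 ∷ 1048579 ∷ 1048593 ∷
  1064969 ∷ 1327425 ∷ 1573953 ∷ 2097425 ∷ 2232577 ∷ 2244609 ∷ 2326533 ∷ 2359553 ∷ 2621457 ∷
  3179041 ∷ 4194305 ∷ 4194435 ∷ 4194465 ∷ 4202561 ∷ 4211201 ∷ 4211721 ∷ 4227209 ∷ 4228001 ∷
  4261889 ∷ 4262465 ∷ 4276257 ∷ 4325553 ∷ 4327427 ∷ 4457097 ∷ 4587561 ∷ 4720645 ∷ 4723217 ∷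
  4754945 ∷ 5242881 ∷ 5263377 ∷ 5275985 ∷ 5308737 ∷ 5324837 ∷ 5378049 ∷ 5390881 ∷ 5506081 ∷
  5767825 ∷ 6292193 ∷ 6307857 ∷ 6340609 ∷ 6357057 ∷ 7342465 ∷ 7864323 ∷ 7866625 ∷ 8388657 ∷
  8389125 ∷ 8389635 ∷ 8390657 ∷ 8391683 ∷ 8392707 ∷ 8392749 ∷ 8392775 ∷ 8396805 ∷ 8396937 ∷
  8397829 ∷ 8398341 ∷ 8405005 ∷ 8405089 ∷ 8407043 ∷ 8420865 ∷ 8421395 ∷ 8429825 ∷ 8454159 ∷
  8454305 ∷ 8454529 ∷ 8458245 ∷ 8458249 ∷ 8462469 ∷ 8519777 ∷ 8519841 ∷ 8519937 ∷ 8525345 ∷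
  8568841 ∷ 8585857 ∷ 8651361 ∷ 8651825 ∷ 8658945 ∷ 8659489 ∷ 8684045 ∷ 8913345 ∷ 8913411 ∷
  8921091 ∷ 8921097 ∷ 8945825 ∷ 8949763 ∷ 8970273 ∷ 9437251 ∷ 9437441 ∷ 9437699 ∷ 9441301 ∷
  9446401 ∷ 9502977 ∷ 9699393 ∷ 9865217 ∷ 9961507 ∷ 9995265 ∷ 10485793 ∷ 10486019 ∷ 10493955 ∷
  10518785 ∷ 10526913 ∷ 10764425 ∷ 11534373 ∷ 11534913 ∷ 12583937 ∷ 12591633 ∷ 12603425 ∷
  12713987 ∷ 12714497 ∷ 12780041 ∷ 13108225 ∷ 13111617 ∷ 13632515 ∷ 13632517 ∷ 13634561 ∷
  13635601 ∷ 14680085 ∷ 16777225 ∷ 16777475 ∷ 16777537 ∷ 16777545 ∷ 16778245 ∷ 16778247 ∷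
  16778249 ∷ 16778273 ∷ 16778407 ∷ 16778881 ∷ 16779273 ∷ 16779305 ∷ 16779429 ∷ 16780033 ∷
  16780329 ∷ 16781445 ∷ 16781601 ∷ 16781633 ∷ 16782339 ∷ 16783361 ∷ 16785429 ∷ 16785925 ∷
  16785987 ∷ 16786513 ∷ 16793905 ∷ 16794625 ∷ 16797705 ∷ 16799745 ∷ 16802049 ∷ 16802311 ∷
  16808069 ∷ 16810033 ∷ 16810497 ∷ 16811525 ∷ 16816129 ∷ 16842771 ∷ 16845073 ∷ 16847937 ∷
  16851009 ∷ 16908325 ∷ 16908485 ∷ 16908549 ∷ 16908867 ∷ 16910481 ∷ 16912649 ∷ 16916481 ∷
  16933377 ∷ 16937025 ∷ 16941249 ∷ 16973957 ∷ 16975875 ∷ 16992833 ∷ 17039369 ∷ 17040449 ∷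
  17047563 ∷ 17047593 ∷ 17048577 ∷ 17061889 ∷ 17073153 ∷ 17104901 ∷ 17105665 ∷ 17121313 ∷
  17170565 ∷ 17174537 ∷ 17301633 ∷ 17301793 ∷ 17301889 ∷ 17303563 ∷ 17305641 ∷ 17318925 ∷
  17319969 ∷ 17432853 ∷ 17465409 ∷ 17563653 ∷ 17564225 ∷ 17630217 ∷ 17760257 ∷ 17825825 ∷
  17825925 ∷ 17829905 ∷ 17834049 ∷ 17834177 ∷ 17836041 ∷ 17895457 ∷ 17960993 ∷ 18645057 ∷
  18874531 ∷ 18875425 ∷ 18878475 ∷ 18879553 ∷ 18883713 ∷ 18890883 ∷ 18919425 ∷ 18925569 ∷
  19136513 ∷ 19136529 ∷ 19138691 ∷ 19141121 ∷ 19144713 ∷ 19398915 ∷ 19399809 ∷ 19431425 ∷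
  19940361 ∷ 20447233 ∷ 20971785 ∷ 20972561 ∷ 20983833 ∷ 21020769 ∷ 21039109 ∷ 21102865 ∷
  21110817 ∷ 21123585 ∷ 21135617 ∷ 21201537 ∷ 21504129 ∷ 21529089 ∷ 21626897 ∷ 22022149 ∷
  23078913 ∷ 23085185 ∷ 25166377 ∷ 25190417 ∷ 25198723 ∷ 25231373 ∷ 25231395 ∷ 25233729 ∷
  25297953 ∷ 25319427 ∷ 25428009 ∷ 25432065 ∷ 25444611 ∷ 25698305 ∷ 26222609 ∷ 26746881 ∷
  27263073 ∷ 27394689 ∷ 28578305 ∷ 29360897 ∷ 29361665 ∷ 29364739 ∷ 29368577 ∷ 29426705 ∷
  30556225 ∷ 33554625 ∷ 33554697 ∷ 33554721 ∷ 33554995 ∷ 33555105 ∷ 33556033 ∷ 33556513 ∷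
  33558541 ∷ 33558555 ∷ 33558561 ∷ 33559047 ∷ 33559581 ∷ 33560625 ∷ 33563649 ∷ 33564419 ∷
  33564675 ∷ 33564971 ∷ 33566593 ∷ 33570823 ∷ 33571073 ∷ 33572241 ∷ 33583137 ∷ 33587253 ∷
  33587393 ∷ 33587745 ∷ 33591305 ∷ 33598467 ∷ 33603841 ∷ 33613825 ∷ 33619985 ∷ 33620067 ∷
  33620265 ∷ 33620741 ∷ 33620769 ∷ 33624085 ∷ 33630209 ∷ 33636435 ∷ 33640449 ∷ 33640497 ∷
  33685545 ∷ 33686545 ∷ 33686803 ∷ 33695747 ∷ 33701925 ∷ 33702273 ∷ 33721345 ∷ 33722625 ∷
  33726469 ∷ 33751041 ∷ 33759297 ∷ 33767685 ∷ 33771521 ∷ 33783813 ∷ 33816585 ∷ 33817603 ∷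
  33819715 ∷ 33820835 ∷ 33824769 ∷ 33835153 ∷ 33849351 ∷ 33859073 ∷ 33865989 ∷ 33882153 ∷
  33915265 ∷ 33947649 ∷ 33955905 ∷ 33980545 ∷ 34013205 ∷ 34078761 ∷ 34079089 ∷ 34080009 ∷
  34080801 ∷ 34080805 ∷ 34082833 ∷ 34082849 ∷ 34083365 ∷ 34087949 ∷ 34093121 ∷ 34103363 ∷
  34107393 ∷ 34144513 ∷ 34209793 ∷ 34209937 ∷ 34242689 ∷ 34341125 ∷ 34343937 ∷ 34351105 ∷
  34373891 ∷ 34609185 ∷ 34613265 ∷ 34615809 ∷ 34623489 ∷ 34624529 ∷ 34734497 ∷ 34734625 ∷
  34866441 ∷ 34889729 ∷ 34930721 ∷ 35127393 ∷ 35128865 ∷ 35135555 ∷ 35139585 ∷ 35225619 ∷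
  35651585 ∷ 35651905 ∷ 35661825 ∷ 35668017 ∷ 35782917 ∷ 35784225 ∷ 35799297 ∷ 35803649 ∷
  35913729 ∷ 35947009 ∷ 36177923 ∷ 36569091 ∷ 36700485 ∷ 36716545 ∷ 37224705 ∷ 37748905 ∷
  37749313 ∷ 37749777 ∷ 37749905 ∷ 37750785 ∷ 37751809 ∷ 37753861 ∷ 37755137 ∷ 37756929 ∷
  37761025 ∷ 37762065 ∷ 37763205 ∷ 37765649 ∷ 37769347 ∷ 37782561 ∷ 37785605 ∷ 37790209 ∷
  37814283 ∷ 37848069 ∷ 37880329 ∷ 37881859 ∷ 37961793 ∷ 38011461 ∷ 38027395 ∷ 38044673 ∷
  38092801 ∷ 38275209 ∷ 38291489 ∷ 38797825 ∷ 38798105 ∷ 38798625 ∷ 38806537 ∷ 39845923 ∷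
  39846401 ∷ 39976965 ∷ 39993345 ∷ 41943111 ∷ 41943809 ∷ 41944581 ∷ 41945105 ∷ 41945617 ∷
  41947137 ∷ 41947157 ∷ 41947425 ∷ 41951241 ∷ 41955459 ∷ 41959437 ∷ 41975813 ∷ 41975939 ∷
  41976897 ∷ 42029057 ∷ 42074449 ∷ 42147845 ∷ 42207363 ∷ 42369537 ∷ 42469377 ∷ 43123713 ∷
  44042753 ∷ 44085249 ∷ 46137491 ∷ 46139649 ∷ 46146561 ∷ 46151681 ∷ 48250881 ∷ 50332173 ∷
  50333569 ∷ 50337869 ∷ 50339857 ∷ 50340101 ∷ 50349063 ∷ 50350091 ∷ 50356737 ∷ 50397187 ∷
  50397261 ∷ 50397265 ∷ 50398245 ∷ 50398433 ∷ 50401929 ∷ 50406785 ∷ 50442305 ∷ 50462731 ∷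
  50463251 ∷ 50463521 ∷ 50511877 ∷ 50532353 ∷ 50593829 ∷ 50598401 ∷ 50627585 ∷ 50876929 ∷
  50880513 ∷ 51216385 ∷ 51380485 ∷ 51381249 ∷ 51382017 ∷ 51396609 ∷ 51513345 ∷ 52498433 ∷
  52723715 ∷ 54525985 ∷ 54528321 ∷ 54595617 ∷ 55050245 ∷ 58721313 ∷ 58916865 ∷ 59244549 ∷
  59785281 ∷ 59801665 ∷ 60852225 ∷ 67108869 ∷ 67108877 ∷ 67108889 ∷ 67108953 ∷ 67109025 ∷
  67109175 ∷ 67109665 ∷ 67109955 ∷ 67109971 ∷ 67110183 ∷ 67110977 ∷ 67110995 ∷ 67111053 ∷
  67111425 ∷ 67112005 ∷ 67112967 ∷ 67113081 ∷ 67113101 ∷ 67113227 ∷ 67114245 ∷ 67115009 ∷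
  67117057 ∷ 67118337 ∷ 67119145 ∷ 67121411 ∷ 67121425 ∷ 67125289 ∷ 67125385 ∷ 67125505 ∷
  67126785 ∷ 67129363 ∷ 67129393 ∷ 67129479 ∷ 67129609 ∷ 67129665 ∷ 67131665 ∷ 67134017 ∷
  67134469 ∷ 67141641 ∷ 67141649 ∷ 67142213 ∷ 67143969 ∷ 67145751 ∷ 67145793 ∷ 67158051 ∷
  67174985 ∷ 67178507 ∷ 67179203 ∷ 67183235 ∷ 67186945 ∷ 67190787 ∷ 67190801 ∷ 67207177 ∷
  67208197 ∷ 67209233 ∷ 67242049 ∷ 67242123 ∷ 67249165 ∷ 67256579 ∷ 67260945 ∷ 67274913 ∷
  67276819 ∷ 67277825 ∷ 67307521 ∷ 67323905 ∷ 67330049 ∷ 67371041 ∷ 67371649 ∷ 67371747 ∷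
  67372065 ∷ 67372229 ∷ 67372547 ∷ 67372677 ∷ 67375107 ∷ 67379205 ∷ 67381251 ∷ 67387397 ∷
  67387911 ∷ 67390465 ∷ 67403921 ∷ 67405313 ∷ 67436685 ∷ 67438145 ∷ 67438617 ∷ 67469325 ∷
  67470337 ∷ 67502097 ∷ 67507201 ∷ 67518465 ∷ 67567619 ∷ 67633181 ∷ 67633205 ∷ 67633293 ∷
  67633345 ∷ 67633735 ∷ 67635459 ∷ 67637261 ∷ 67637505 ∷ 67637793 ∷ 67643905 ∷ 67701249 ∷
  67766465 ∷ 67768449 ∷ 67973633 ∷ 68026433 ∷ 68026753 ∷ 68158497 ∷ 68159729 ∷ 68166213 ∷
  68174337 ∷ 68182081 ∷ 68194305 ∷ 68222991 ∷ 68223105 ∷ 68292609 ∷ 68419591 ∷ 68419717 ∷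
  68420641 ∷ 68747585 ∷ 68952325 ∷ 69206025 ∷ 69207073 ∷ 69207305 ∷ 69214225 ∷ 69222945 ∷
  69230625 ∷ 69239555 ∷ 69272849 ∷ 69279813 ∷ 69306433 ∷ 69345315 ∷ 69373953 ∷ 69468225 ∷
  69484809 ∷ 69731337 ∷ 69732369 ∷ 69738625 ∷ 70320129 ∷ 70516745 ∷ 70582273 ∷ 71303185 ∷
  71303685 ∷ 71305479 ∷ 71336193 ∷ 71340225 ∷ 71385153 ∷ 71436321 ∷ 71443505 ∷ 71565765 ∷
  71663625 ∷ 71827717 ∷ 71829505 ∷ 71839751 ∷ 71843841 ∷ 71893125 ∷ 73400585 ∷ 73531425 ∷
  73605121 ∷ 73957377 ∷ 75500035 ∷ 75501571 ∷ 75505985 ∷ 75513921 ∷ 75530769 ∷ 75533601 ∷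
  75546753 ∷ 75579395 ∷ 75628563 ∷ 75760321 ∷ 75792395 ∷ 75857985 ∷ 75890725 ∷ 76027905 ∷
  76153473 ∷ 76580361 ∷ 76742913 ∷ 76813313 ∷ 77594881 ∷ 77594985 ∷ 77597185 ∷ 77627395 ∷
  77627409 ∷ 77660289 ∷ 79692977 ∷ 79693201 ∷ 79709185 ∷ 79962113 ∷ 82313217 ∷ 83886401 ∷
  83886593 ∷ 83890311 ∷ 83894337 ∷ 83902467 ∷ 83907681 ∷ 83910723 ∷ 83935235 ∷ 83939393 ∷
  83943425 ∷ 83980305 ∷ 84017165 ∷ 84017187 ∷ 84410625 ∷ 84445221 ∷ 84476417 ∷ 84476993 ∷
  84609281 ∷ 86245505 ∷ 86245665 ∷ 88080449 ∷ 88088609 ∷ 88639491 ∷ 89131009 ∷ 92274689 ∷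
  93585925 ∷ 94380039 ∷ 95437825 ∷ 100663297 ∷ 100663395 ∷ 100676225 ∷ 100679685 ∷ 100683841 ∷
  100685313 ∷ 100696323 ∷ 100698409 ∷ 100929545 ∷ 100941953 ∷ 100958721 ∷ 100991505 ∷
  101122049 ∷ 101205005 ∷ 101318657 ∷ 101712113 ∷ 101752833 ∷ 101974081 ∷ 101974275 ∷
  102760577 ∷ 103024705 ∷ 103811089 ∷ 104857605 ∷ 104923139 ∷ 105021441 ∷ 109062689 ∷
  109068417 ∷ 109080577 ∷ 109084805 ∷ 109121545 ∷ 109315089 ∷ 112198913 ∷ 113246225 ∷
  117579777 ∷ 117736465 ∷ 121638917 ∷ 121913363 ∷ 127926337 ∷ 134217735 ∷ 134217993 ∷
  134218017 ∷ 134218261 ∷ 134218497 ∷ 134218765 ∷ 134218819 ∷ 134218825 ∷ 134219861 ∷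
  134221873 ∷ 134222273 ∷ 134223955 ∷ 134225921 ∷ 134226449 ∷ 134226473 ∷ 134227329 ∷
  134230019 ∷ 134234125 ∷ 134236225 ∷ 134238217 ∷ 134238219 ∷ 134251013 ∷ 134251587 ∷
  134252225 ∷ 134252633 ∷ 134254657 ∷ 134266929 ∷ 134268675 ∷ 134284425 ∷ 134285667 ∷
  134288385 ∷ 134291457 ∷ 134316037 ∷ 134316097 ∷ 134340673 ∷ 134348849 ∷ 134350595 ∷
  134350855 ∷ 134351109 ∷ 134356997 ∷ 134358021 ∷ 134365249 ∷ 134420481 ∷ 134479891 ∷
  134483469 ∷ 134484097 ∷ 134486209 ∷ 134490625 ∷ 134502401 ∷ 134506721 ∷ 134565905 ∷
  134565921 ∷ 134578273 ∷ 134602785 ∷ 134612995 ∷ 134676489 ∷ 134742025 ∷ 134742027 ∷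
  134742529 ∷ 134743817 ∷ 134744195 ∷ 134744337 ∷ 134746133 ∷ 134759041 ∷ 134767651 ∷
  134775043 ∷ 134814225 ∷ 134864961 ∷ 134873121 ∷ 134874401 ∷ 134877573 ∷ 134889473 ∷
  134889489 ∷ 134889505 ∷ 135004675 ∷ 135012361 ∷ 135090305 ∷ 135217281 ∷ 135266435 ∷
  135272545 ∷ 135283745 ∷ 135288849 ∷ 135291457 ∷ 135292929 ∷ 135294993 ∷ 135300105 ∷
  135307527 ∷ 135323681 ∷ 135413889 ∷ 135438337 ∷ 135481345 ∷ 135528965 ∷ 135529475 ∷
  135530529 ∷ 135531009 ∷ 135538689 ∷ 135660033 ∷ 135700481 ∷ 135791625 ∷ 135811105 ∷
  135827651 ∷ 136052739 ∷ 136052801 ∷ 136316609 ∷ 136319233 ∷ 136332161 ∷ 136351809 ∷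
  136354825 ∷ 136358145 ∷ 136447553 ∷ 136839235 ∷ 137363589 ∷ 138412545 ∷ 138412817 ∷
  138415365 ∷ 138416169 ∷ 138440961 ∷ 138461185 ∷ 138479625 ∷ 138486801 ∷ 138543745 ∷
  138680333 ∷ 138936359 ∷ 138940513 ∷ 138940977 ∷ 138954753 ∷ 139067913 ∷ 139495425 ∷
  139498625 ∷ 139532289 ∷ 139724817 ∷ 140771345 ∷ 142606467 ∷ 142610499 ∷ 142672409 ∷
  142737537 ∷ 142743713 ∷ 142753921 ∷ 142884873 ∷ 143196165 ∷ 143393025 ∷ 143654985 ∷
  143655441 ∷ 143661441 ∷ 143663113 ∷ 143689729 ∷ 143753345 ∷ 144705729 ∷ 144716065 ∷
  144742915 ∷ 145309737 ∷ 145752065 ∷ 146801921 ∷ 147464209 ∷ 147853349 ∷ 150999233 ∷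
  151003177 ∷ 151035987 ∷ 151060481 ∷ 151078437 ∷ 151142405 ∷ 151195651 ∷ 151257601 ∷
  151273475 ∷ 151781441 ∷ 151799297 ∷ 152045589 ∷ 152078465 ∷ 152178689 ∷ 153100305 ∷
  153133057 ∷ 155205665 ∷ 155320325 ∷ 155525121 ∷ 159385601 ∷ 159389057 ∷ 167774217 ∷
  167774243 ∷ 167776393 ∷ 167778469 ∷ 167821317 ∷ 167837697 ∷ 167838209 ∷ 167854113 ∷
  167903361 ∷ 167904009 ∷ 167938241 ∷ 167945225 ∷ 168034579 ∷ 168050725 ∷ 168119329 ∷
  168296577 ∷ 168321153 ∷ 168560641 ∷ 168839297 ∷ 169885889 ∷ 176169217 ∷ 176171009 ∷
  176261121 ∷ 177209345 ∷ 177210371 ∷ 178276617 ∷ 178651265 ∷ 180371457 ∷ 184549513 ∷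
  184558081 ∷ 184614923 ∷ 193216513 ∷ 201327105 ∷ 201327361 ∷ 201327665 ∷ 201328657 ∷
  201328961 ∷ 201338881 ∷ 201344001 ∷ 201458961 ∷ 201588801 ∷ 201855105 ∷ 201867299 ∷
  201884353 ∷ 201979905 ∷ 201990157 ∷ 202510341 ∷ 202653825 ∷ 203425025 ∷ 203489297 ∷
  205586433 ∷ 209723393 ∷ 209723409 ∷ 209739777 ∷ 218300481 ∷ 236978177 ∷ 239222801 ∷
  268435475 ∷ 268435553 ∷ 268435593 ∷ 268435635 ∷ 268435713 ∷ 268436481 ∷ 268436997 ∷
  268438547 ∷ 268438849 ∷ 268439625 ∷ 268440225 ∷ 268444215 ∷ 268451847 ∷ 268452433 ∷
  268453477 ∷ 268457985 ∷ 268460049 ∷ 268460423 ∷ 268460545 ∷ 268468995 ∷ 268469409 ∷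
  268473089 ∷ 268473345 ∷ 268473857 ∷ 268474401 ∷ 268476561 ∷ 268484769 ∷ 268486785 ∷
  268493315 ∷ 268502081 ∷ 268509349 ∷ 268566561 ∷ 268566593 ∷ 268566661 ∷ 268566913 ∷
  268567057 ∷ 268583427 ∷ 268584449 ∷ 268611609 ∷ 268621025 ∷ 268634121 ∷ 268698129 ∷
  268705827 ∷ 268714017 ∷ 268734725 ∷ 268745985 ∷ 268771353 ∷ 268871697 ∷ 268959795 ∷
  268959937 ∷ 268961797 ∷ 268963865 ∷ 268963905 ∷ 268976133 ∷ 268993945 ∷ 269000737 ∷
  269037585 ∷ 269158401 ∷ 269369345 ∷ 269488129 ∷ 269488197 ∷ 269500425 ∷ 269517193 ∷
  269520905 ∷ 269549569 ∷ 269560865 ∷ 269592641 ∷ 269714529 ∷ 269746177 ∷ 269878533 ∷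
  270008585 ∷ 270008753 ∷ 270025217 ∷ 270098737 ∷ 270238787 ∷ 270422145 ∷ 270532617 ∷
  270532877 ∷ 270533645 ∷ 270549513 ∷ 270598285 ∷ 270604337 ∷ 270608405 ∷ 270622743 ∷
  270628369 ∷ 270663939 ∷ 270796929 ∷ 270802945 ∷ 271647809 ∷ 271712385 ∷ 272630017 ∷
  272630019 ∷ 272637965 ∷ 272656659 ∷ 272696325 ∷ 272908289 ∷ 273154113 ∷ 273166481 ∷
  273744001 ∷ 274743329 ∷ 276836417 ∷ 276856867 ∷ 276856905 ∷ 276857865 ∷ 276890117 ∷
  276971585 ∷ 277086385 ∷ 277350433 ∷ 277893125 ∷ 281019393 ∷ 281019409 ∷ 281083905 ∷
  281149991 ∷ 285212721 ∷ 285213705 ∷ 285219329 ∷ 285287425 ∷ 285349893 ∷ 285753345 ∷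
  286261409 ∷ 287311889 ∷ 287572225 ∷ 289472641 ∷ 289539137 ∷ 293615105 ∷ 294671361 ∷
  297820225 ∷ 301999137 ∷ 302023937 ∷ 302252039 ∷ 302252673 ∷ 302516225 ∷ 303301665 ∷
  304291841 ∷ 306184209 ∷ 306188801 ∷ 310378699 ∷ 310394881 ∷ 310419585 ∷ 310444291 ∷
  310510593 ∷ 313524225 ∷ 318808577 ∷ 335544321 ∷ 335545345 ∷ 335545353 ∷ 335545413 ∷
  335556625 ∷ 335562785 ∷ 335583237 ∷ 335806593 ∷ 336070657 ∷ 336070665 ∷ 336200193 ∷
  336740353 ∷ 337655809 ∷ 339738657 ∷ 340531233 ∷ 344203785 ∷ 348131329 ∷ 353386517 ∷
  353632257 ∷ 361234433 ∷ 369101075 ∷ 370458689 ∷ 400556033 ∷ 402654217 ∷ 402661377 ∷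
  402669569 ∷ 402669605 ∷ 402694145 ∷ 402725697 ∷ 402791065 ∷ 402928929 ∷ 403048673 ∷
  403136577 ∷ 404815905 ∷ 406980611 ∷ 407896065 ∷ 411042307 ∷ 411043845 ∷ 411043971 ∷
  419432449 ∷ 420479041 ∷ 437300225 ∷ 444596481 ∷ 470286341 ∷ 474218497 ∷ 478167555 ∷
  482344961 ∷ 536870921 ∷ 536871699 ∷ 536871985 ∷ 536873217 ∷ 536874625 ∷ 536875083 ∷
  536879125 ∷ 536879265 ∷ 536884545 ∷ 536904225 ∷ 536911881 ∷ 536938501 ∷ 536981537 ∷
  536986629 ∷ 536993853 ∷ 537001985 ∷ 537002241 ∷ 537110049 ∷ 537133579 ∷ 537167909 ∷
  537180745 ∷ 537202737 ∷ 537393153 ∷ 537404355 ∷ 537415813 ∷ 537428097 ∷ 537443649 ∷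
  537485465 ∷ 537545229 ∷ 537833481 ∷ 538085025 ∷ 538681857 ∷ 538861649 ∷ 538902529 ∷
  538968339 ∷ 538969105 ∷ 538976517 ∷ 539230215 ∷ 539262977 ∷ 539887809 ∷ 540557313 ∷
  541065227 ∷ 541229409 ∷ 541659265 ∷ 542282785 ∷ 542707971 ∷ 542904705 ∷ 544224513 ∷
  544342657 ∷ 544523265 ∷ 545259521 ∷ 545260065 ∷ 545312901 ∷ 545390849 ∷ 545460545 ∷
  545558529 ∷ 545785857 ∷ 546309179 ∷ 546407937 ∷ 546472201 ∷ 546570753 ∷ 546583809 ∷
  547390705 ∷ 547668041 ∷ 553707525 ∷ 553746449 ∷ 553877505 ∷ 553914369 ∷ 553916421 ∷
  554174467 ∷ 554696961 ∷ 555246337 ∷ 555745329 ∷ 558188549 ∷ 562036801 ∷ 570462225 ∷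
  570962945 ∷ 571514881 ∷ 571736705 ∷ 572522529 ∷ 579600385 ∷ 587202569 ∷ 587620353 ∷
  603983941 ∷ 604110857 ∷ 604111233 ∷ 605328513 ∷ 605421633 ∷ 606076929 ∷ 606340385 ∷
  608175125 ∷ 620773505 ∷ 621806465 ∷ 637566977 ∷ 641839105 ∷ 664797185 ∷ 671088713 ∷
  671236097 ∷ 671301635 ∷ 671615813 ∷ 671619073 ∷ 671678785 ∷ 672712833 ∷ 705761283 ∷
  713033729 ∷ 805306633 ∷ 805306881 ∷ 805675585 ∷ 805715973 ∷ 805978131 ∷ 806985733 ∷
  807321665 ∷ 809566209 ∷ 809599105 ∷ 811876617 ∷ 813694977 ∷ 874680325 ∷ 1040187425 ∷
  1073741837 ∷ 1073741841 ∷ 1073742345 ∷ 1073750029 ∷ 1073775105 ∷ 1073786433 ∷ 1073807425 ∷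
  1073808387 ∷ 1073808393 ∷ 1073827841 ∷ 1073841201 ∷ 1073910097 ∷ 1074008577 ∷ 1074036737 ∷
  1074228225 ∷ 1074294371 ∷ 1074399657 ∷ 1074430037 ∷ 1074561041 ∷ 1074856097 ∷ 1074858369 ∷
  1075251333 ∷ 1075389281 ∷ 1075507713 ∷ 1075576833 ∷ 1075838981 ∷ 1075973219 ∷ 1078034433 ∷
  1078057605 ∷ 1078470915 ∷ 1078984835 ∷ 1080601345 ∷ 1081081857 ∷ 1082130441 ∷ 1082138625 ∷
  1082189313 ∷ 1082472705 ∷ 1082497041 ∷ 1086325761 ∷ 1090552329 ∷ 1092620289 ∷ 1092812833 ∷
  1094279425 ∷ 1099169825 ∷ 1105528833 ∷ 1107296769 ∷ 1107344385 ∷ 1107443905 ∷ 1107486321 ∷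
  1107820579 ∷ 1108873255 ∷ 1112014865 ∷ 1140859145 ∷ 1140869121 ∷ 1140899841 ∷ 1142247681 ∷
  1145241601 ∷ 1186988033 ∷ 1207992849 ∷ 1208147969 ∷ 1213005825 ∷ 1232093187 ∷ 1241580033 ∷
  1275076737 ∷ 1342210113 ∷ 1342210177 ∷ 1476397073 ∷ 1509951641 ∷ 1509954657 ∷ 1610747905 ∷
  1620049921 ∷ 1678770177 ∷ 1879048193 ∷ 1879085057 ∷ 1881153545 ∷ 1946164741 ∷ 2147483679 ∷
  2147484169 ∷ 2147486211 ∷ 2147500035 ∷ 2147501069 ∷ 2147516481 ∷ 2147517441 ∷ 2147519265 ∷
  2147520515 ∷ 2147540625 ∷ 2147550273 ∷ 2147567625 ∷ 2147843081 ∷ 2147844205 ∷ 2148007969 ∷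
  2148008101 ∷ 2148010017 ∷ 2148044801 ∷ 2148303465 ∷ 2148532225 ∷ 2148536625 ∷ 2148544529 ∷
  2148565009 ∷ 2148665345 ∷ 2148975117 ∷ 2149056513 ∷ 2149756433 ∷ 2150296153 ∷ 2150633473 ∷
  2151680017 ∷ 2151687681 ∷ 2151710723 ∷ 2155888705 ∷ 2156397057 ∷ 2160078137 ∷ 2160373765 ∷
  2164260993 ∷ 2164531205 ∷ 2181038337 ∷ 2187329595 ∷ 2189426817 ∷ 2189459585 ∷ 2189950977 ∷
  2206203905 ∷ 2214592513 ∷ 2214602597 ∷ 2214658057 ∷ 2218852361 ∷ 2233524233 ∷ 2281701379 ∷
  2290094597 ∷ 2415919137 ∷ 2415919145 ∷ 2415919169 ∷ 2415921697 ∷ 2416967745 ∷ 2420375553 ∷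
  2451308551 ∷ 2684371203 ∷ 2684420225 ∷ 2686145025 ∷ 2688548865 ∷ 3221229585 ∷ 3221310465 ∷
  3238027265 ∷ 3825208775 ∷ 4143972353 ∷ 4294967297 ∷ 4294967427 ∷ 4294968585 ∷ 4294969365 ∷
  4294975489 ∷ 4294979585 ∷ 4295001091 ∷ 4295032833 ∷ 4295032865 ∷ 4295036931 ∷ 4295132161 ∷
  4295229445 ∷ 4295491595 ∷ 4296020099 ∷ 4296802313 ∷ 4296810893 ∷ 4297631829 ∷ 4298064005 ∷
  4299178241 ∷ 4303357441 ∷ 4303880193 ∷ 4305977345 ∷ 4315940865 ∷ 4320264193 ∷ 4329570369 ∷
  4362078225 ∷ 4362140673 ∷ 4362862593 ∷ 4363190273 ∷ 4373160009 ∷ 4429185285 ∷ 4429191169 ∷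
  4431298563 ∷ 4437573633 ∷ 4497342465 ∷ 4517265409 ∷ 4563403281 ∷ 4563453985 ∷ 4563775489 ∷
  4580876545 ∷ 4831969289 ∷ 4833951745 ∷ 5368840193 ∷ 5370806337 ∷ 5385486337 ∷ 6509559825 ∷
  6576669185 ∷ 6979977225 ∷ 7516290821 ∷ 7616856065 ∷ 8589935235 ∷ 8589938691 ∷ 8590067745 ∷
  8590117005 ∷ 8590199297 ∷ 8590458891 ∷ 8591245313 ∷ 8592043409 ∷ 8594129921 ∷ 8594202625 ∷
  8595833185 ∷ 8599154691 ∷ 8600162725 ∷ 8606449665 ∷ 8606712835 ∷ 8608808961 ∷ 8638365825 ∷
  8657043489 ∷ 8657043969 ∷ 8657044277 ∷ 8709513219 ∷ 8740930689 ∷ 8757706769 ∷ 9126805505 ∷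
  9665773665 ∷ 9680454153 ∷ 9797899265 ∷ 10737418305 ∷ 12884902401 ∷ 12885662049 ∷
  12952010753 ∷ 17179869185 ∷ 17179885697 ∷ 17179901953 ∷ 17179936773 ∷ 17180131353 ∷
  17180173003 ∷ 17180885117 ∷ 17181525319 ∷ 17184063489 ∷ 17185014393 ∷ 17188257795 ∷
  17196680193 ∷ 17213423633 ∷ 17246978433 ∷ 17247051793 ∷ 17450401891 ∷ 17717264385 ∷
  17717456897 ∷ 18253611137 ∷ 18791006209 ∷ 21474844677 ∷ 21474967617 ∷ 25904022529 ∷
  26038243329 ∷ 34359738501 ∷ 34359747585 ∷ 34359748609 ∷ 34360970481 ∷ 34384912385 ∷
  34393295873 ∷ 34393423877 ∷ 34393424065 ∷ 34426851329 ∷ 34426880033 ∷ 34493972481 ∷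
  34661728257 ∷ 34779611159 ∷ 35031351297 ∷ 35433480321 ∷ 35567698945 ∷ 36540776449 ∷
  38656278529 ∷ 38658965505 ∷ 42949673985 ∷ 42951778305 ∷ 44023414785 ∷ 51539607561 ∷
  51543867395 ∷ 68719476821 ∷ 68719478787 ∷ 68719481857 ∷ 68719493125 ∷ 68719501377 ∷
  68719537665 ∷ 68723941377 ∷ 68727865361 ∷ 68727869441 ∷ 68786847745 ∷ 68820144129 ∷
  68853825537 ∷ 68855791745 ∷ 69256347665 ∷ 69264736257 ∷ 69794267137 ∷ 69794525185 ∷
  85903540225 ∷ 103079215105 ∷ 137438969859 ∷ 137439874575 ∷ 137442788601 ∷ 137572122625 ∷
  137975828481 ∷ 137994600507 ∷ 138412163127 ∷ 139460821005 ∷ 139590631425 ∷ 156766306305 ∷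
  206158430721 ∷ 274877906961 ∷ 274877907201 ∷ 274878147845 ∷ 274878675425 ∷ 274922471765 ∷
  275548995585 ∷ 275951714305 ∷ 278770974735 ∷ 412316860417 ∷ 412316925953 ∷ 549755814401 ∷
  549755815945 ∷ 549755830273 ∷ 549755879553 ∷ 549764071677 ∷ 549780848765 ∷ 549822926849 ∷
  551920074753 ∷ 554184998913 ∷ 584115554305 ∷ 1099511631875 ∷ 1099511644417 ∷ 1099511660673 ∷
  1099513724931 ∷ 1099513725953 ∷ 1099523686877 ∷ 1099524938225 ∷ 1099578736641 ∷
  1106092163127 ∷ 1116691497985 ∷ 1168231235585 ∷ 1374389534721 ∷ 1649300996097 ∷
  2199023258625 ∷ 2199023263777 ∷ 2199023780353 ∷ 2199094558721 ∷ 2199123918849 ∷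
  2199157473285 ∷ 2199174250497 ∷ 2233382994049 ∷ 2267742736385 ∷ 2267759509505 ∷
  2757369004033 ∷ 4398046511249 ∷ 4398046511425 ∷ 4398046515233 ∷ 4398046544385 ∷
  4398048641025 ∷ 4398050836481 ∷ 4398078626297 ∷ 4398717599745 ∷ 4406787047547 ∷
  4415226380293 ∷ 4440996184065 ∷ 4552665333761 ∷ 4672928612353 ∷ 5016521801729 ∷
  8796093022353 ∷ 8796193685505 ∷ 8864812498947 ∷ 8933532041217 ∷ 17592186044421 ∷
  17592186044673 ∷ 17592186044675 ∷ 17592186044937 ∷ 17592186046593 ∷ 17592186077193 ∷
  17592186077441 ∷ 17592186568769 ∷ 17592188142081 ∷ 17592252629501 ∷ 17592386846973 ∷
  17593293340673 ∷ 17594333528073 ∷ 17594333528193 ∷ 17596481011729 ∷ 17609365913857 ∷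
  18691697704961 ∷ 26388279074817 ∷ 35184372088849 ∷ 35184372097025 ∷ 70368744179713 ∷
  70437463654401 ∷ 140737488355585 ∷ 281474976714753 ∷ 562949953486849 ∷ 562950490292225 ∷
  1125917086711809 ∷ 4503599631564801 ∷ 9007199256838145 ∷ 18014398509482241 ∷
  18014398643699713 ∷ 36046389205008385 ∷ 144115188075855905 ∷ 144115188075986945 ∷
  576465150349934593 ∷ 1152922604118474753 ∷ 4611686018427387913 ∷ 18446744074783293441 ∷
  36893488147419111425 ∷ 36893488147452657665 ∷ 36893490346442358785 ∷ 590295810908461465601 ∷
  590295811458217279489 ∷ 1180591638309597347841 ∷ 2361183241436970090497 ∷
  9444733528689243848705 ∷ 9444805023333328355329 ∷ 9739880870918643253249 ∷
  18889465931547300331521 ∷ 75557863725914324467713 ∷ 75705437678503999832065 ∷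
  302231455185132270387201 ∷ 604462909807314587353601 ∷ 1208925819614629174771713 ∷
  1208925819614629241815041 ∷ 1208925819614631322189825 ∷ 1208925891672223212634113 ∷
  4835703278458516698824707 ∷ 4835703278458516698826753 ∷ 7253554917687775048237057 ∷
  38685626227668133591646209 ∷ 38685626299725727628525569 ∷ 38685663121156281009700865 ∷
  77371252455336267449630721 ∷ 154742504910673084118204417 ∷ 154742504928686932871872513 ∷
  309485009821345068733169665 ∷ 1237940039285380274899124481 ∷ 1237944761651863144544337921 ∷
  20116525638387429467110768641 ∷ 5070602400915223448996026515457 ∷
  20282409603651674927546878656513 ∷ 1329227995784915872903807060280410113 ∷
  5070602400912917605986812822529 ∷ 145135534866465 ∷ 2475880078570760549798248705 ∷
  22835963083295358096932575511191922182123962369 ∷ 52776560230401 ∷ 18016597532868609 ∷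
  9223934986841751553 ∷ 4503599628419137 ∷ 37154696925937665 ∷ 1688852007747585 ∷
  35184376283141 ∷ 54043470406352897 ∷ 2251937252639745 ∷ 43997644980225 ∷ 1126449796874241 ∷
  18014467363176449 ∷ 1152922604185583617 ∷ 70643622608897 ∷ 2251809477361665 ∷
  563499709759489 ∷ 36028797018965025 ∷ 140737488371721 ∷ 2251799947911169 ∷ 70369281048581 ∷
  290271338168321 ∷ 563018672898305 ∷ 558345757185 ∷ 562950021054465 ∷ 9007199255797761 ∷
  9024791442882561 ∷ 4504699155775489 ∷ 35188801273857 ∷ 9007199255273473 ∷ 4504716318867457 ∷
  1266774834151425 ∷ 288230393331646465 ∷ 72058693549555721 ∷ 68719476825 ∷ 68719476945 ∷
  549773123585 ∷ 687211544705 ∷ 274894979073 ∷ 2201170749441 ∷ 68720526849 ∷ 138512695365 ∷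
  4398063813121 ∷ 140737798733825 ∷ 4947807043585 ∷ 68733108225 ∷ 1103806660641 ∷
  1100585631777 ∷ 68719624195 ∷ 9895940194305 ∷ 350039834625 ∷ 13194139537425 ∷ 4952098340865 ∷
  85932900369 ∷ 343664623617 ∷ 688268574721 ∷ 4466833620993 ∷ 8796093026945 ∷ 2748921675777 ∷
  4398717599809 ∷ 290279659667459 ∷ 140806210191361 ∷ 550830081025 ∷ 154619872257 ∷
  17643725656065 ∷ 558479970369 ∷ []

-- Divisors d of sporadic numbers n all of whose multiples have at least s₂ n ones.
moduli : List ℕ
moduli =
  63 ∷ 31 ∷ 127 ∷ 15 ∷ 455 ∷ 3855 ∷ 51 ∷ 7 ∷ 31775 ∷ 85 ∷ 89 ∷ 233 ∷ 399 ∷ 258111 ∷ 23 ∷ 47 ∷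
  79 ∷ 103 ∷ 123 ∷ 187 ∷ 223 ∷ 771 ∷ 3813 ∷ 13107 ∷ 13923 ∷ []

searchWith : (ℕ → Bool) → (j : ℕ) → List ℕ → Bool
searchWith form j sporadic =
  search j (3 ∷ 5 ∷ 7 ∷ []) (Resolve.resolve form j (2 ^ j) runMultipliers multipliers sparseMultiples sporadic 40)

searchWith-sound : ∀ form j sporadic → searchWith form j sporadic ≡ true →
                   ∀ n → Odd n → zeros n ≡ j → Flimsy n ⊎ (n ∈ sporadic ⊎ HasForm form n)
searchWith-sound form j sporadic h n odd z =
  either (inj₁ ∘ flimsy) (λ outcome → outcome)
    (search-sound j (3 ∷ 5 ∷ 7 ∷ []) _ n (Equivalence.from T-≡ h) odd z
      (λ P l d → Resolve.resolve-sound form j (2 ^ j) runMultipliers multipliers sparseMultiples sporadic 40 P l d refl))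
  where
  flimsy : Any (λ k → s₂ (k * n) < s₂ n) (3 ∷ 5 ∷ 7 ∷ []) → Flimsy n
  flimsy (here lt)                 = 3 , z<s , lt
  flimsy (there (here lt))         = 5 , z<s , lt
  flimsy (there (there (here lt))) = 7 , z<s , lt

-- For two to four zeros the complementary families are spelled out as digit strings, so the
-- admissible `x` are listed; from five zeros on every positive `x` is accepted.
memberOf : List ℕ → ℕ → Bool
memberOf xs x = any (x ≡ᵇ_) xs

HasForm-memberOf : ∀ xs {n} → HasForm (memberOf xs) n →
                   ∃[ x ] (x ∈ xs × (x > 0 → OnesBetween (binary x) (complement (binary x)) n))
HasForm-memberOf xs {n} (x , s , x∈xs , x< , eq) =
  x , Any.map (≡ᵇ⇒≡ x _) (any⁻ (x ≡ᵇ_) xs x∈xs) , λ x>0 → complementary n x s x>0 x< eq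

HasForm-positive : ∀ {n} → HasForm (0 <ᵇ_) n → ComplementaryForm n
HasForm-positive {n} (x , s , x>0 , x< , eq) = x , <ᵇ⇒< 0 x x>0 , complementary n x s (<ᵇ⇒< 0 x x>0) x< eq

exceptComplementary : ∀ j sporadic → searchWith (0 <ᵇ_) j sporadic ≡ true → allCertified moduli sporadic ≡ true →
                      OddFlimsyExcept j (λ n → n ∈ sporadic ⊎ OddComplementaryForm j n)
exceptComplementary j sporadic h certified = flimsyExcept complete sturdy
  where
  complete : ∀ n → Odd n → zeros n ≡ j → Flimsy n ⊎ (n ∈ sporadic ⊎ OddComplementaryForm j n)
  complete n odd z = Sum.map₂ (Sum.map₂ (λ f → odd , z , HasForm-positive f))
                              (searchWith-sound (0 <ᵇ_) j sporadic h n odd z)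
  sturdy : ∀ n → n ∈ sporadic ⊎ OddComplementaryForm j n → Sturdy n
  sturdy n (inj₁ n∈)                       = allCertified-sound moduli sporadic (Equivalence.from T-≡ certified) n∈
  sturdy n (inj₂ (_ , _ , x , x>0 , form)) = complementary⇒sturdy x x>0 form

isFive : Pattern → Bool
isFive (end v ℓ)         = v ≡ᵇ 5
isFive (segment _ _ _ _) = false

-- The claim names its multipliers, so the tree runs with 3 and 5 alone and a leaf is accepted only
-- if it is the number 5. The argument `tt` stands for the evaluated search.
oneZero : ∀ n → Odd n → zeros n ≡ 1 → (s₂ (3 * n) < s₂ n ⊎ s₂ (5 * n) < s₂ n) ⊎ n ≡ 5
oneZero n odd z = Sum.map₁ split (search-sound 1 (3 ∷ 5 ∷ []) (λ P → isFive (compile P (end 0 0))) n tt odd z five)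
  where
  split : Any (λ k → s₂ (k * n) < s₂ n) (3 ∷ 5 ∷ []) → s₂ (3 * n) < s₂ n ⊎ s₂ (5 * n) < s₂ n
  split (here lt)         = inj₁ lt
  split (there (here lt)) = inj₂ lt
  matched : ∀ Q {n L} → T (isFive Q) → Matches Q n L → n ≡ 5
  matched (end v ℓ) h (end refl _) = ≡ᵇ⇒≡ v 5 h
  five : ∀ P → T (isFive (compile P (end 0 0))) → Denotes P n (s₂ n + 1) → n ≡ 5
  five P h d = subst (_≡ 5) (trans (cong (n +_) (*-zeroʳ (2 ^ (s₂ n + 1)))) (+-identityʳ n))
                     (matched (compile P (end 0 0)) h (compile-sound d (end refl refl)))

certified⇒sturdy : ∀ ns → allCertified moduli ns ≡ true → ∀ {n} → n ∈ ns → Sturdy n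
certified⇒sturdy ns certified = allCertified-sound moduli ns (Equivalence.from T-≡ certified)

search₂ : searchWith (memberOf (2 ∷ [])) 2 (51 ∷ []) ≡ true
search₂ = refl

two : OddFlimsyExcept 2 (λ n → n ≡ 51 ⊎ OnesBetween (1 ∷ 0 ∷ []) (0 ∷ 1 ∷ []) n)
two = flimsyExcept complete sturdy
  where
  complete : ∀ n → Odd n → zeros n ≡ 2 → Flimsy n ⊎ (n ≡ 51 ⊎ OnesBetween (1 ∷ 0 ∷ []) (0 ∷ 1 ∷ []) n)
  complete n odd z with searchWith-sound (memberOf (2 ∷ [])) 2 (51 ∷ []) search₂ n odd z
  ... | inj₁ flimsy             = inj₁ flimsy
  ... | inj₂ (inj₁ (here n≡51)) = inj₂ (inj₁ n≡51)
  ... | inj₂ (inj₂ f) with HasForm-memberOf (2 ∷ []) f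
  -- Once `x` is known to be 2, `binary` and `complement` evaluate to the two strings of the
  -- statement.
  ... | _ , here refl , form    = inj₂ (inj₂ (form z<s))
  sturdy : ∀ n → n ≡ 51 ⊎ OnesBetween (1 ∷ 0 ∷ []) (0 ∷ 1 ∷ []) n → Sturdy n
  sturdy n (inj₁ n≡51) = certified⇒sturdy (51 ∷ []) refl (here n≡51)
  sturdy n (inj₂ form) = complementary⇒sturdy 2 z<s form

E₃ : ℕ → Set
E₃ = λ n →
  n ∈ (17 ∷ 85 ∷ 89 ∷ 455 ∷ [])
  ⊎ OnesBetween (1 ∷ 0 ∷ 0 ∷ []) (0 ∷ 1 ∷ 1 ∷ []) n
  ⊎ OnesBetween (1 ∷ 1 ∷ 0 ∷ []) (0 ∷ 0 ∷ 1 ∷ []) n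

search₃ : searchWith (memberOf (4 ∷ 6 ∷ [])) 3 (17 ∷ 85 ∷ 89 ∷ 455 ∷ []) ≡ true
search₃ = refl

three : OddFlimsyExcept 3 E₃
three = flimsyExcept complete sturdy
  where
  complete : ∀ n → Odd n → zeros n ≡ 3 → Flimsy n ⊎ E₃ n
  complete n odd z with searchWith-sound (memberOf (4 ∷ 6 ∷ [])) 3 (17 ∷ 85 ∷ 89 ∷ 455 ∷ []) search₃ n odd z
  ... | inj₁ flimsy    = inj₁ flimsy
  ... | inj₂ (inj₁ n∈) = inj₂ (inj₁ n∈)
  ... | inj₂ (inj₂ f) with HasForm-memberOf (4 ∷ 6 ∷ []) f
  ... | _ , here refl , form = inj₂ (inj₂ (inj₁ (form z<s)))
  ... | _ , there (here refl) , form = inj₂ (inj₂ (inj₂ (form z<s)))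
  sturdy : ∀ n → E₃ n → Sturdy n
  sturdy n (inj₁ n∈) = certified⇒sturdy (17 ∷ 85 ∷ 89 ∷ 455 ∷ []) refl n∈
  sturdy n (inj₂ (inj₁ form)) = complementary⇒sturdy 4 z<s form
  sturdy n (inj₂ (inj₂ (form))) = complementary⇒sturdy 6 z<s form

E₄ : ℕ → Set
E₄ = λ n →
  n ∈ (33 ∷ 69 ∷ 73 ∷ 153 ∷ 3855 ∷ [])
  ⊎ OnesBetween (1 ∷ 0 ∷ 0 ∷ 0 ∷ []) (0 ∷ 1 ∷ 1 ∷ 1 ∷ []) n
  ⊎ OnesBetween (1 ∷ 1 ∷ 0 ∷ 0 ∷ []) (0 ∷ 0 ∷ 1 ∷ 1 ∷ []) n
  ⊎ OnesBetween (1 ∷ 0 ∷ 1 ∷ 0 ∷ []) (0 ∷ 1 ∷ 0 ∷ 1 ∷ []) n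
  ⊎ OnesBetween (1 ∷ 1 ∷ 1 ∷ 0 ∷ []) (0 ∷ 0 ∷ 0 ∷ 1 ∷ []) n

search₄ : searchWith (memberOf (8 ∷ 12 ∷ 10 ∷ 14 ∷ [])) 4 (33 ∷ 69 ∷ 73 ∷ 153 ∷ 3855 ∷ []) ≡ true
search₄ = refl

four : OddFlimsyExcept 4 E₄
four = flimsyExcept complete sturdy
  where
  complete : ∀ n → Odd n → zeros n ≡ 4 → Flimsy n ⊎ E₄ n
  complete n odd z with searchWith-sound (memberOf (8 ∷ 12 ∷ 10 ∷ 14 ∷ [])) 4 (33 ∷ 69 ∷ 73 ∷ 153 ∷ 3855 ∷ []) search₄ n odd z
  ... | inj₁ flimsy    = inj₁ flimsy
  ... | inj₂ (inj₁ n∈) = inj₂ (inj₁ n∈)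
  ... | inj₂ (inj₂ f) with HasForm-memberOf (8 ∷ 12 ∷ 10 ∷ 14 ∷ []) f
  ... | _ , here refl , form = inj₂ (inj₂ (inj₁ (form z<s)))
  ... | _ , there (here refl) , form = inj₂ (inj₂ (inj₂ (inj₁ (form z<s))))
  ... | _ , there (there (here refl)) , form = inj₂ (inj₂ (inj₂ (inj₂ (inj₁ (form z<s)))))
  ... | _ , there (there (there (here refl))) , form = inj₂ (inj₂ (inj₂ (inj₂ (inj₂ (form z<s)))))
  sturdy : ∀ n → E₄ n → Sturdy n
  sturdy n (inj₁ n∈) = certified⇒sturdy (33 ∷ 69 ∷ 73 ∷ 153 ∷ 3855 ∷ []) refl n∈
  sturdy n (inj₂ (inj₁ form)) = complementary⇒sturdy 8 z<s form
  sturdy n (inj₂ (inj₂ (inj₁ form))) = complementary⇒sturdy 12 z<s form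
  sturdy n (inj₂ (inj₂ (inj₂ (inj₁ form)))) = complementary⇒sturdy 10 z<s form
  sturdy n (inj₂ (inj₂ (inj₂ (inj₂ (form))))) = complementary⇒sturdy 14 z<s form

sporadic₅ : List ℕ
sporadic₅ =
  65 ∷ 133 ∷ 161 ∷ 267 ∷ 275 ∷ 1365 ∷ 31775 ∷ []

sporadic₆ : List ℕ
sporadic₆ =
  129 ∷ 259 ∷ 261 ∷ 273 ∷ 385 ∷ 525 ∷ 549 ∷ 561 ∷ 585 ∷ 645 ∷ 657 ∷ 705 ∷ 771 ∷ 777 ∷ 801 ∷
  1729 ∷ 1801 ∷ 2275 ∷ 3185 ∷ 11565 ∷ 13107 ∷ 258111 ∷ []

sporadic₇ : List ℕ
sporadic₇ =
  257 ∷ 515 ∷ 517 ∷ 529 ∷ 1035 ∷ 1065 ∷ 1105 ∷ 1155 ∷ 1157 ∷ 1185 ∷ 1285 ∷ 1545 ∷ 1665 ∷ 2077 ∷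
  2201 ∷ 2325 ∷ 2449 ∷ 2573 ∷ 2697 ∷ 2821 ∷ 2945 ∷ 19065 ∷ 19275 ∷ 21845 ∷ 26985 ∷ 95325 ∷
  2080895 ∷ []

sporadic₈ : List ℕ
sporadic₈ =
  513 ∷ 1027 ∷ 1029 ∷ 1057 ∷ 1281 ∷ 2055 ∷ 2085 ∷ 2089 ∷ 2097 ∷ 2115 ∷ 2145 ∷ 2193 ∷ 2313 ∷
  2337 ∷ 2563 ∷ 2565 ∷ 2625 ∷ 3075 ∷ 3105 ∷ 3585 ∷ 4123 ∷ 4185 ∷ 4371 ∷ 4389 ∷ 4433 ∷ 4619 ∷
  4675 ∷ 4681 ∷ 4867 ∷ 4929 ∷ 5187 ∷ 6169 ∷ 6417 ∷ 6665 ∷ 6913 ∷ 8253 ∷ 8505 ∷ 8525 ∷ 8645 ∷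
  8757 ∷ 9009 ∷ 9261 ∷ 9513 ∷ 9765 ∷ 10017 ∷ 10269 ∷ 10465 ∷ 10521 ∷ 10773 ∷ 11025 ∷ 11277 ∷
  11529 ∷ 11781 ∷ 12033 ∷ 12483 ∷ 13505 ∷ 14497 ∷ 18631 ∷ 25623 ∷ 34695 ∷ 39321 ∷ 42405 ∷
  50115 ∷ 57825 ∷ 158875 ∷ 222425 ∷ 774333 ∷ 16711935 ∷ []

sporadic₉ : List ℕ
sporadic₉ =
  1025 ∷ 2051 ∷ 2057 ∷ 2065 ∷ 2177 ∷ 3073 ∷ 4131 ∷ 4165 ∷ 4233 ∷ 4361 ∷ 4369 ∷ 4417 ∷ 4641 ∷
  5129 ∷ 5185 ∷ 6273 ∷ 8215 ∷ 8277 ∷ 8339 ∷ 8401 ∷ 8711 ∷ 8773 ∷ 8835 ∷ 8897 ∷ 10261 ∷ 10385 ∷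
  10757 ∷ 10881 ∷ 12307 ∷ 12369 ∷ 12803 ∷ 12865 ∷ 14353 ∷ 14849 ∷ 16443 ∷ 16569 ∷ 16835 ∷
  16947 ∷ 17073 ∷ 17451 ∷ 17577 ∷ 17745 ∷ 17955 ∷ 18081 ∷ 18459 ∷ 18585 ∷ 18963 ∷ 19089 ∷
  19467 ∷ 19593 ∷ 19971 ∷ 20097 ∷ 24605 ∷ 24633 ∷ 25025 ∷ 25137 ∷ 25641 ∷ 26145 ∷ 26649 ∷
  26691 ∷ 27153 ∷ 27657 ∷ 28161 ∷ 28679 ∷ 32893 ∷ 33401 ∷ 33909 ∷ 34417 ∷ 34925 ∷ 35433 ∷
  35941 ∷ 36449 ∷ 36957 ∷ 37465 ∷ 37973 ∷ 38481 ∷ 38989 ∷ 39497 ∷ 40005 ∷ 40513 ∷ 41021 ∷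
  41529 ∷ 41769 ∷ 42037 ∷ 42545 ∷ 43053 ∷ 43561 ∷ 44069 ∷ 44577 ∷ 45085 ∷ 45593 ∷ 46101 ∷
  46609 ∷ 47117 ∷ 47625 ∷ 48133 ∷ 48641 ∷ 178481 ∷ 285975 ∷ 349525 ∷ 413075 ∷ 476625 ∷
  1290555 ∷ 1806777 ∷ 1864135 ∷ 6242685 ∷ 133956095 ∷ []

search₅ : searchWith (0 <ᵇ_) 5 sporadic₅ ≡ true
search₅ = refl

certified₅ : allCertified moduli sporadic₅ ≡ true
certified₅ = refl

five : OddFlimsyExcept 5 (λ n → n ∈ sporadic₅ ⊎ OddComplementaryForm 5 n)
five = exceptComplementary 5 sporadic₅ search₅ certified₅

search₆ : searchWith (0 <ᵇ_) 6 sporadic₆ ≡ true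
search₆ = refl

certified₆ : allCertified moduli sporadic₆ ≡ true
certified₆ = refl

six : OddFlimsyExcept 6 (λ n → n ∈ sporadic₆ ⊎ OddComplementaryForm 6 n)
six = exceptComplementary 6 sporadic₆ search₆ certified₆

search₇ : searchWith (0 <ᵇ_) 7 sporadic₇ ≡ true
search₇ = refl

certified₇ : allCertified moduli sporadic₇ ≡ true
certified₇ = refl

seven : OddFlimsyExcept 7 (λ n → n ∈ sporadic₇ ⊎ OddComplementaryForm 7 n)
seven = exceptComplementary 7 sporadic₇ search₇ certified₇

search₈ : searchWith (0 <ᵇ_) 8 sporadic₈ ≡ true
search₈ = refl

certified₈ : allCertified moduli sporadic₈ ≡ true
certified₈ = refl

eight : OddFlimsyExcept 8 (λ n → n ∈ sporadic₈ ⊎ OddComplementaryForm 8 n)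
eight = exceptComplementary 8 sporadic₈ search₈ certified₈

search₉ : searchWith (0 <ᵇ_) 9 sporadic₉ ≡ true
search₉ = refl

certified₉ : allCertified moduli sporadic₉ ≡ true
certified₉ = refl

nine : OddFlimsyExcept 9 (λ n → n ∈ sporadic₉ ⊎ OddComplementaryForm 9 n)
nine = exceptComplementary 9 sporadic₉ search₉ certified₉

theorem15 : (∀ n → n > 0 → zeros n ≡ 0 → Sturdy n) ×
    OddFlimsyExcept 1 (λ n → n ≡ 5) ×
    (∀ n → Odd n → zeros n ≡ 1 → n ≢ 5 → s₂ (3 * n) < s₂ n ⊎ s₂ (5 * n) < s₂ n) ×
    OddFlimsyExcept 2 (λ n →
    n ≡ 51 ⊎ OnesBetween (1 ∷ 0 ∷ []) (0 ∷ 1 ∷ []) n) ×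
    OddFlimsyExcept 3 (λ n →
    n ∈ (17 ∷ 85 ∷ 89 ∷ 455 ∷ [])
    ⊎ OnesBetween (1 ∷ 0 ∷ 0 ∷ []) (0 ∷ 1 ∷ 1 ∷ []) n
    ⊎ OnesBetween (1 ∷ 1 ∷ 0 ∷ []) (0 ∷ 0 ∷ 1 ∷ []) n) ×
    OddFlimsyExcept 4 (λ n →
    n ∈ (33 ∷ 69 ∷ 73 ∷ 153 ∷ 3855 ∷ [])
    ⊎ OnesBetween (1 ∷ 0 ∷ 0 ∷ 0 ∷ []) (0 ∷ 1 ∷ 1 ∷ 1 ∷ []) n
    ⊎ OnesBetween (1 ∷ 1 ∷ 0 ∷ 0 ∷ []) (0 ∷ 0 ∷ 1 ∷ 1 ∷ []) n
    ⊎ OnesBetween (1 ∷ 0 ∷ 1 ∷ 0 ∷ []) (0 ∷ 1 ∷ 0 ∷ 1 ∷ []) n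
    ⊎ OnesBetween (1 ∷ 1 ∷ 1 ∷ 0 ∷ []) (0 ∷ 0 ∷ 0 ∷ 1 ∷ []) n) ×
    OddFlimsyExcept 5 (λ n →
    n ∈ (65 ∷ 133 ∷ 161 ∷ 267 ∷ 275 ∷ 1365 ∷ 31775 ∷ [])
    ⊎ OddComplementaryForm 5 n) ×
    OddFlimsyExcept 6 (λ n →
    n ∈ (129 ∷ 259 ∷ 261 ∷ 273 ∷ 385 ∷ 525 ∷ 549 ∷ 561 ∷ 585 ∷ 645 ∷ 657 ∷
    705 ∷ 771 ∷ 777 ∷ 801 ∷ 1729 ∷ 1801 ∷ 2275 ∷ 3185 ∷ 11565 ∷ 13107 ∷
    258111 ∷ [])
    ⊎ OddComplementaryForm 6 n) ×
    OddFlimsyExcept 7 (λ n →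
    n ∈ (257 ∷ 515 ∷ 517 ∷ 529 ∷ 1035 ∷ 1065 ∷ 1105 ∷ 1155 ∷ 1157 ∷ 1185 ∷
    1285 ∷ 1545 ∷ 1665 ∷ 2077 ∷ 2201 ∷ 2325 ∷ 2449 ∷ 2573 ∷ 2697 ∷ 2821 ∷
    2945 ∷ 19065 ∷ 19275 ∷ 21845 ∷ 26985 ∷ 95325 ∷ 2080895 ∷ [])
    ⊎ OddComplementaryForm 7 n) ×
    OddFlimsyExcept 8 (λ n →
    n ∈ (513 ∷ 1027 ∷ 1029 ∷ 1057 ∷ 1281 ∷ 2055 ∷ 2085 ∷ 2089 ∷ 2097 ∷ 2115 ∷
    2145 ∷ 2193 ∷ 2313 ∷ 2337 ∷ 2563 ∷ 2565 ∷ 2625 ∷ 3075 ∷ 3105 ∷ 3585 ∷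
    4123 ∷ 4185 ∷ 4371 ∷ 4389 ∷ 4433 ∷ 4619 ∷ 4675 ∷ 4681 ∷ 4867 ∷ 4929 ∷
    5187 ∷ 6169 ∷ 6417 ∷ 6665 ∷ 6913 ∷ 8253 ∷ 8505 ∷ 8525 ∷ 8645 ∷ 8757 ∷
    9009 ∷ 9261 ∷ 9513 ∷ 9765 ∷ 10017 ∷ 10269 ∷ 10465 ∷ 10521 ∷ 10773 ∷
    11025 ∷ 11277 ∷ 11529 ∷ 11781 ∷ 12033 ∷ 12483 ∷ 13505 ∷ 14497 ∷
    18631 ∷ 25623 ∷ 34695 ∷ 39321 ∷ 42405 ∷ 50115 ∷ 57825 ∷ 158875 ∷
    222425 ∷ 774333 ∷ 16711935 ∷ [])
    ⊎ OddComplementaryForm 8 n) ×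
    OddFlimsyExcept 9 (λ n →
    n ∈ (1025 ∷ 2051 ∷ 2057 ∷ 2065 ∷ 2177 ∷ 3073 ∷ 4131 ∷ 4165 ∷ 4233 ∷ 4361 ∷
    4369 ∷ 4417 ∷ 4641 ∷ 5129 ∷ 5185 ∷ 6273 ∷ 8215 ∷ 8277 ∷ 8339 ∷ 8401 ∷
    8711 ∷ 8773 ∷ 8835 ∷ 8897 ∷ 10261 ∷ 10385 ∷ 10757 ∷ 10881 ∷ 12307 ∷
    12369 ∷ 12803 ∷ 12865 ∷ 14353 ∷ 14849 ∷ 16443 ∷ 16569 ∷ 16835 ∷
    16947 ∷ 17073 ∷ 17451 ∷ 17577 ∷ 17745 ∷ 17955 ∷ 18081 ∷ 18459 ∷
    18585 ∷ 18963 ∷ 19089 ∷ 19467 ∷ 19593 ∷ 19971 ∷ 20097 ∷ 24605 ∷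
    24633 ∷ 25025 ∷ 25137 ∷ 25641 ∷ 26145 ∷ 26649 ∷ 26691 ∷ 27153 ∷
    27657 ∷ 28161 ∷ 28679 ∷ 32893 ∷ 33401 ∷ 33909 ∷ 34417 ∷ 34925 ∷
    35433 ∷ 35941 ∷ 36449 ∷ 36957 ∷ 37465 ∷ 37973 ∷ 38481 ∷ 38989 ∷
    39497 ∷ 40005 ∷ 40513 ∷ 41021 ∷ 41529 ∷ 41769 ∷ 42037 ∷ 42545 ∷
    43053 ∷ 43561 ∷ 44069 ∷ 44577 ∷ 45085 ∷ 45593 ∷ 46101 ∷ 46609 ∷
    47117 ∷ 47625 ∷ 48133 ∷ 48641 ∷ 178481 ∷ 285975 ∷ 349525 ∷ 413075 ∷
    476625 ∷ 1290555 ∷ 1806777 ∷ 1864135 ∷ 6242685 ∷ 133956095 ∷ [])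
    ⊎ OddComplementaryForm 9 n)
theorem15 =
  zeros≡0⇒sturdy ,
  flimsyExcept
    (λ n odd z → Sum.map₁ (either (λ lt → 3 , z<s , lt) (λ lt → 5 , z<s , lt)) (oneZero n odd z))
    (λ { n n≡5 → certified⇒sturdy (5 ∷ []) refl (here n≡5) }) ,
  (λ n odd z n≢5 → either (λ lt → lt) (λ n≡5 → contradiction n≡5 n≢5) (oneZero n odd z)) ,
  two , three , four , five , six , seven , eight , nine
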